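{- For every $n\ge1$ there is a bijection $\phi^{(B)}_C:\mathcal{CUD}^{(B)}_n\to\mathcal{T}^\circ_n$ which, for each $1\le k\le n$, restricts to a bijection from $\mathcal{CUD}^{(B)}_{n,k}$ onto $\mathcal{T}^\circ_{n,k}$.
   Context: A signed permutation of $[n]$ is a bijection $\sigma$ of $[\pm n]$ with $\sigma(-i)=-\sigma(i)$; $\bar a=-a$; cycles on $[\pm n]$ are written $(c_1,\dots,c_r)$ with $\sigma(c_j)=c_{j+1}$, $\sigma(c_r)=c_1$. $\mathcal{CUD}^{(B)}_n$: signed permutations with no cycle $C=-C$ such that, writing the cycle notation $(a_{1,1},a_{1,2},\dots)\cdots(a_{m,1},\dots)$ — one cycle from each pair $\{C,-C\}$, the one in which the entry of smallest absolute value is positive, written starting with that entry, with $a_{1,1}<\dots<a_{m,1}$ — each cycle satisfies $|a_{i,1}|<|a_{i,2}|>|a_{i,3}|<\cdots$. $\mathcal{CUD}^{(B)}_{n,k}$: those with $a_{m,1}=k$. $\mathcal{T}_n$ is the set of complete increasing binary trees with $n$ labelled nodes: plane rooted trees in which every node is either a leaf or has exactly two ordered children (left, right), exactly $n$ nodes carry labels, bijectively from $[n]$, every non-leaf node is labelled (leaves may be labelled or unlabelled; unlabelled leaves are called empty), and labels increase along every path from the root. The rightmost path is $(v_1,\dots,v_d)$, $v_1$ the root, $v_{i+1}$ the right child of $v_i$, $v_d$ a leaf (the rightmost leaf). $\mathcal{T}^\circ_n$ ($\mathcal{T}^*_n$): trees whose rightmost leaf is empty (labelled). The rightmost label is the label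 of $v_{d-1}$ for $\tau\in\mathcal{T}^\circ_n$ and of $v_d$ for $\tau\in\mathcal{T}^*_n$. $\mathcal{T}^\circ_{n,k}$, $\mathcal{T}^*_{n,k}$: those with rightmost label $k$. -}

module Defs where

open import Data.Nat using (ℕ; zero; suc; _≤_; _<_)
open import Data.Bool using (Bool; true; false; not; if_then_else_)
open import Data.Integer as ℤ using (ℤ; +_; -[1+_]; ∣_∣; -_)
open import Data.List using (List; []; _∷_; map; upTo; _++_)
open import Data.List.Relation.Unary.All using (All)
open import Data.List.Relation.Binary.Permutation.Propositional using (_↭_)
open import Data.Maybe using (Maybe; just; nothing)
open import Data.Product using (_×_)
open import Data.Unit using (⊤)
open import Relation.Nullary using (¬_)
open import Relation.Binary.PropositionalEquality using (_≡_; _≢_)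

range : ℕ → List ℕ
range n = map suc (upTo n)

-- Signed permutations of [n].
-- A signed permutation σ of [±n] (a bijection with σ(-i) = -σ(i)) is
-- determined by its window (σ(1), ..., σ(n)) ∈ ℤ^n, and the window
-- determines a signed permutation iff (|σ(1)|, ..., |σ(n)|) is a
-- permutation of [n].  We store the window; the validity proof is
-- irrelevant, so two signed permutations are equal iff their windows are.

record SignedPerm (n : ℕ) : Set where
  constructor mkSP
  field
    window : List ℤ
    .valid : map ∣_∣ window ↭ range n
open SignedPerm public

lookupD : List ℤ → ℕ → ℤ
lookupD []      _       = + 0
lookupD (x ∷ _) zero    = x
lookupD (_ ∷ w) (suc i) = lookupD w i

apply : ∀ {n} → SignedPerm n → ℤ → ℤ
apply σ (+ zero)   = + 0
apply σ (+ suc i)  = lookupD (window σ) i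
apply σ -[1+ i ]   = - lookupD (window σ) i

iter : ∀ {n} → SignedPerm n → ℕ → ℤ → ℤ
iter σ zero    x = x
iter σ (suc j) x = apply σ (iter σ j x)

In± : ℕ → ℤ → Set
In± n x = 1 ≤ ∣ x ∣ × ∣ x ∣ ≤ n

NoSelfNegCycle : ∀ {n} → SignedPerm n → Set
NoSelfNegCycle {n} σ = ∀ x → In± n x → ∀ j → iter σ j x ≢ - x

-- x ∈ [n] is the first entry of a written cycle: x > 0 is the entry of
-- smallest absolute value in its cycle.
IsLeader : ∀ {n} → SignedPerm n → ℕ → Set
IsLeader {n} σ x = 1 ≤ x × x ≤ n × (∀ j → x ≤ ∣ iter σ j (+ x) ∣)

CycleLength : ∀ {n} → SignedPerm n → ℤ → ℕ → Set
CycleLength σ x r = 1 ≤ r × iter σ r x ≡ x × (∀ j → 1 ≤ j → j < r → iter σ j x ≢ x)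

isEven : ℕ → Bool
isEven zero    = true
isEven (suc i) = not (isEven i)

-- comparison required between |a_{i+1}| and |a_{i+2}| (i 0-based)
UpDownAt : ℕ → ℕ → ℕ → Set
UpDownAt i a b = if isEven i then a < b else b < a

-- The cycle written from x, (a_1, ..., a_r) with a_{i+1} = σ^i(x), satisfies
-- |a_1| < |a_2| > |a_3| < ...
Alternating : ∀ {n} → SignedPerm n → ℤ → Set
Alternating σ x = ∀ r → CycleLength σ x r → ∀ i → suc i < r →
  UpDownAt i ∣ iter σ i x ∣ ∣ iter σ (suc i) x ∣

IsCUD : ∀ {n} → SignedPerm n → Set
IsCUD σ = NoSelfNegCycle σ × (∀ x → IsLeader σ x → Alternating σ (+ x))

record CUD (n : ℕ) : Set where
  constructor mkCUD
  field
    perm   : SignedPerm n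
    .isCUD : IsCUD perm
open CUD public

LastLeaderIs : ∀ {n} → CUD n → ℕ → Set
LastLeaderIs c k = IsLeader (perm c) k × (∀ x → IsLeader (perm c) x → x ≤ k)

-- Complete binary trees: every node is a leaf (empty: nothing, or
-- labelled: just l) or an internal labelled node with left/right child.

data Tree : Set where
  leaf : Maybe ℕ → Tree
  node : ℕ → Tree → Tree → Tree

labels : Tree → List ℕ
labels (leaf nothing)  = []
labels (leaf (just l)) = l ∷ []
labels (node x l r)    = x ∷ labels l ++ labels r

Increasing : Tree → Set
Increasing (leaf _)     = ⊤
Increasing (node x l r) =
  All (x <_) (labels l) × All (x <_) (labels r) × Increasing l × Increasing r

rightmostLeaf : Tree → Maybe ℕ
rightmostLeaf (leaf m)     = m
rightmostLeaf (node _ _ r) = rightmostLeaf r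

-- label of v_{d-1} (the rightmost label of a tree in T°)
rightmostLabel° : Tree → Maybe ℕ
rightmostLabel° (leaf _)                = nothing
rightmostLabel° (node x _ (leaf _))     = just x
rightmostLabel° (node _ _ (node y l r)) = rightmostLabel° (node y l r)

record T° (n : ℕ) : Set where
  constructor mkT°
  field
    tree        : Tree
    .labelling  : labels tree ↭ range n
    .increasing : Increasing tree
    .emptyRight : rightmostLeaf tree ≡ nothing
open T° public

-- Both families are increasing sequences of pairs (k , X), with k the minimum of its block: X is a signed
-- word w with |w₁| > |w₂| < |w₃| > …, for a cycle (k , w₁ , w₂ , …), or a left subtree, for a node k of the
-- rightmost path.  So the last leader matches the rightmost label as soon as signed words on a set of
-- letters correspond to trees on the same labels.  Let ±m be the letter of smallest absolute value of w.
-- If it is + m, then w = u m v with u of odd length (or w = m, a labelled leaf) and u, v are again such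
-- words: the tree is node m with subtrees those of u and v.  If it is - m, first apply to w the
-- order-reversing permutation of its letters (signs travelling with the letters).  The result has the form
-- u (- m) v with u of even length, hence reverse u and v are again such words.  The parity of the length of
-- the left word tells the two cases apart.
module Submission where

open import Defs
open import Data.Nat using (ℕ; zero; suc; _+_; _∸_; _≤_; _<_; z≤n; s≤s; s≤s⁻¹; z<s)
import Data.Nat.Properties as ℕ
open import Data.Integer using (ℤ; +_; -[1+_]; ∣_∣; -_)
import Data.Integer.Properties as ℤ
open import Data.Fin using (Fin; zero; suc; toℕ; opposite; fromℕ<)
open import Data.Fin.Properties using (opposite-prop; opposite-involutive; pigeonhole; toℕ-fromℕ<; toℕ<n; toℕ-injective)
open import Data.List using (List; []; _∷_; [_]; map; _++_; length; lookup; reverse; _ʳ++_; concatMap; upTo; filter; applyUpTo; _∷ʳ_)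
open import Data.List.Properties using (length-map; map-∘; map-cong-local; map-id-local; length-reverse; reverse-involutive; map-++; length-++; length-upTo; ≡-dec)
open import Data.List.Relation.Unary.All as All using (All; []; _∷_; all?)
import Data.List.Relation.Unary.All.Properties as All
open import Data.List.Relation.Unary.AllPairs as AllPairs using (AllPairs; []; _∷_)
import Data.List.Relation.Unary.AllPairs.Properties as AllPairs
open import Data.List.Relation.Unary.Any using (here; there; index)
open import Data.List.Relation.Unary.Any.Properties using (lookup-index)
open import Data.List.Relation.Unary.Unique.Propositional using (Unique)
open import Data.List.Relation.Unary.Sorted.TotalOrder.Properties using (Sorted⇒AllPairs)
open import Data.List.Membership.Propositional using (_∈_; find; lose)
open import Data.List.Membership.Propositional.Properties using (∈-∃++; ∈-map⁺; ∈-map⁻; ∈-lookup; ∈-++⁻; ∈-insert; ∈-upTo⁺; ∈-upTo⁻; ∈-concatMap⁺; ∈-concatMap⁻; ∈-filter⁺; ∈-filter⁻)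
open import Data.List.Membership.DecPropositional ℤ._≟_ using (_∈?_)
open import Data.List.Relation.Binary.Permutation.Propositional using (_↭_; ↭-refl; ↭-sym; ↭-trans; prep; ↭⇒↭ₛ; ↭-reflexive)
open import Data.List.Relation.Binary.Permutation.Propositional.Properties using (shift; ∈-resp-↭; ↭-length; ↭-reverse; ++⁺; ++⁺ʳ; All-resp-↭; ∷↭∷ʳ) renaming (map⁺ to ↭-map⁺)
import Data.List.Relation.Binary.Permutation.Setoid.Properties as ↭ₛ
import Data.List.Sort
import Relation.Binary.Construct.On as On
open import Data.Product using (Σ; _×_; _,_; proj₁; proj₂; ∃; ∃₂)
open import Data.Sum using (_⊎_; inj₁; inj₂)
open import Relation.Nullary using (yes; no; contradiction; recompute; map′; _×-dec_)
open import Relation.Binary using (Rel; Symmetric; Asymmetric; tri<; tri≈; tri>; DecidableEquality)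
open import Relation.Binary.PropositionalEquality using (_≡_; _≢_; refl; sym; trans; cong; cong₂; subst; subst₂; setoid; resp₂)
open import Function using (_∘_; _on_; id)
open import Level using (0ℓ)
open import Data.Bool using (Bool; true; false; not; if_then_else_)
open import Data.Bool.Properties using (not-involutive)
open import Data.Unit using (⊤; tt)
open import Data.Maybe using (Maybe; just; nothing)
open import Relation.Unary using (Decidable)
import Data.Maybe.Properties as Maybe
open import Function.Bundles using (_↔_; _⇔_; Inverse; mk↔ₛ′; mk⇔)

-- Lists without repetition up to permutation, and strictly sorted lists

allPairs-++⁻ : ∀ {A : Set} {R : Rel A 0ℓ} xs {ys} → AllPairs R (xs ++ ys) →
  AllPairs R xs × AllPairs R ys × All (λ x → All (R x) ys) xs
allPairs-++⁻ [] ps = [] , ps , []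
allPairs-++⁻ (x ∷ xs) (p ∷ ps) with pxs , pys , cross ← allPairs-++⁻ xs ps =
  All.++⁻ˡ xs p ∷ pxs , pys , All.++⁻ʳ xs p ∷ cross

AllPairs-resp-↭ : ∀ {A : Set} {R : Rel A 0ℓ} → Symmetric R → ∀ {xs ys} → xs ↭ ys → AllPairs R xs → AllPairs R ys
AllPairs-resp-↭ {A} {R} sym p = ↭ₛ.AllPairs-resp-↭ (setoid A) sym (resp₂ R) (↭⇒↭ₛ p)

Unique-resp-↭ : ∀ {A : Set} {xs ys : List A} → xs ↭ ys → Unique xs → Unique ys
Unique-resp-↭ = AllPairs-resp-↭ (λ x≢y y≡x → x≢y (sym y≡x))

-- Induction on `xs`: its head is moved to the front of `ys`, and uniqueness on both sides lets it
-- be cancelled from the two inclusions.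
unique-sets⇒↭ : ∀ {A : Set} {xs ys : List A} → Unique xs → Unique ys →
  (∀ {z} → z ∈ xs → z ∈ ys) → (∀ {z} → z ∈ ys → z ∈ xs) → xs ↭ ys
unique-sets⇒↭ {xs = []} {[]} _ _ _ _ = ↭-refl
unique-sets⇒↭ {xs = []} {y ∷ ys} _ _ _ g with () ← g (here refl)
unique-sets⇒↭ {xs = x ∷ xs} (x∉xs ∷ uxs) uys f g with a , b , refl ← ∈-∃++ (f (here refl))
  with x∉ab ∷ uab ← Unique-resp-↭ (shift x a b) uys =
  ↭-trans (prep x (unique-sets⇒↭ uxs uab f′ g′)) (↭-sym (shift x a b))
  where
  f′ : ∀ {z} → z ∈ xs → z ∈ a ++ b
  f′ z∈xs with ∈-resp-↭ (shift x a b) (f (there z∈xs))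
  ... | here refl = contradiction refl (All.lookup x∉xs z∈xs)
  ... | there z∈ab = z∈ab
  g′ : ∀ {z} → z ∈ a ++ b → z ∈ xs
  g′ z∈ab with g (∈-resp-↭ (↭-sym (shift x a b)) (there z∈ab))
  ... | here refl = contradiction refl (All.lookup x∉ab z∈ab)
  ... | there z∈xs = z∈xs

-- If the heads differed, each would occur in the tail of the other list and so precede the other,
-- against asymmetry.
sorted-sets⇒≡ : ∀ {A : Set} {R : Rel A 0ℓ} → Asymmetric R → ∀ {xs ys} → AllPairs R xs → AllPairs R ys →
  (∀ {z} → z ∈ xs → z ∈ ys) → (∀ {z} → z ∈ ys → z ∈ xs) → xs ≡ ys
sorted-sets⇒≡ asym {[]} {[]} _ _ _ _ = refl
sorted-sets⇒≡ asym {[]} {_ ∷ _} _ _ _ g with () ← g (here refl)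
sorted-sets⇒≡ asym {_ ∷ _} {[]} _ _ f _ with () ← f (here refl)
sorted-sets⇒≡ {R = R} asym {x ∷ xs} {y ∷ ys} (rx ∷ rxs) (ry ∷ rys) f g with x≡y
  where
  x≡y : x ≡ y
  x≡y with f (here refl) | g (here refl)
  ... | here p | _ = p
  ... | there _ | here q = sym q
  ... | there p | there q = contradiction (All.lookup rx q) (asym (All.lookup ry p))
... | refl = cong (x ∷_) (sorted-sets⇒≡ asym rxs rys
  (λ z∈ → tail rx z∈ (f (there z∈))) (λ z∈ → tail ry z∈ (g (there z∈))))
  where
  tail : ∀ {z zs ws} → All (R x) zs → z ∈ zs → z ∈ x ∷ ws → z ∈ ws
  tail r z∈ (here refl) = contradiction (All.lookup r z∈) (asym (All.lookup r z∈))
  tail r z∈ (there p) = p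

-- Complementation of words

infix 4 _≺_
_≺_ : ℤ → ℤ → Set
x ≺ y = ∣ x ∣ < ∣ y ∣

≺-asym : Asymmetric _≺_
≺-asym = ℕ.<-asym

_#_ : ℤ → ℤ → Set
x # y = ∣ x ∣ ≢ ∣ y ∣

Distinct : List ℤ → Set
Distinct = AllPairs _#_

Distinct-resp-↭ : ∀ {xs ys} → xs ↭ ys → Distinct xs → Distinct ys
Distinct-resp-↭ = AllPairs-resp-↭ (λ x≢y y≡x → x≢y (sym y≡x))

distinct⇒unique : ∀ {xs} → Distinct xs → Unique xs
distinct⇒unique = AllPairs.map (λ x#y x≡y → x#y (cong ∣_∣ x≡y))

open Data.List.Sort (On.decTotalOrder ℕ.≤-decTotalOrder ∣_∣) using (sort; sort-↭; sort-↗) public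

sort-≺ : ∀ {w} → Distinct w → AllPairs _≺_ (sort w)
sort-≺ {w} d = AllPairs.map (λ (p , q) → ℕ.≤∧≢⇒< p q) (AllPairs.zip
  (Sorted⇒AllPairs (On.totalOrder ℕ.≤-totalOrder ∣_∣) (sort-↗ w) , Distinct-resp-↭ (↭-sym (sort-↭ w)) d))

-- For `S` sorted by absolute value this sends the i-th smallest letter to the i-th largest. Off `S`
-- it is the identity, which makes it total.
opp : List ℤ → ℤ → ℤ
opp S z with z ∈? S
... | yes p = lookup S (opposite (index p))
... | no _ = z

lookup-mono : ∀ {S} → AllPairs _≺_ S → ∀ i j → toℕ i < toℕ j → lookup S i ≺ lookup S j
lookup-mono (r ∷ _) zero (suc j) _ = All.lookup r (∈-lookup j)
lookup-mono (_ ∷ rs) (suc i) (suc j) (s≤s i<j) = lookup-mono rs i j i<j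

lookup-cancel : ∀ {S} → AllPairs _≺_ S → ∀ i j → lookup S i ≺ lookup S j → toℕ i < toℕ j
lookup-cancel s i j r with ℕ.<-cmp (toℕ i) (toℕ j)
... | tri< p _ _ = p
... | tri≈ _ p _ with refl ← toℕ-injective p = contradiction r (ℕ.<-irrefl refl)
... | tri> _ _ p = contradiction r (ℕ.<-asym (lookup-mono s j i p))

lookup-injective : ∀ {S} → AllPairs _≺_ S → ∀ i j → lookup S i ≡ lookup S j → i ≡ j
lookup-injective {S} s i j e with ℕ.<-cmp (toℕ i) (toℕ j)
... | tri< p _ _ = contradiction (lookup-mono s i j p) (ℕ.<-irrefl (cong ∣_∣ e))
... | tri≈ _ p _ = toℕ-injective p
... | tri> _ _ p = contradiction (lookup-mono s j i p) (ℕ.<-irrefl (cong ∣_∣ (sym e)))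

-- The membership test returns some position of `lookup S i`; a strictly sorted list has only one.
opp-lookup : ∀ {S} → AllPairs _≺_ S → ∀ i → opp S (lookup S i) ≡ lookup S (opposite i)
opp-lookup {S} s i with lookup S i ∈? S
... | yes p = cong (lookup S ∘ opposite) (lookup-injective s _ _ (sym (lookup-index p)))
... | no ¬p = contradiction (∈-lookup i) ¬p

opposite-mono : ∀ {n} (i j : Fin n) → toℕ i < toℕ j → toℕ (opposite j) < toℕ (opposite i)
opposite-mono i j i<j rewrite opposite-prop i | opposite-prop j =
  ℕ.∸-monoʳ-< (s≤s i<j) (Data.Fin.Properties.toℕ<n j)

module _ {S} (s : AllPairs _≺_ S) where

  opp-∈ : ∀ {z} → z ∈ S → opp S z ∈ S
  opp-∈ p rewrite lookup-index p | opp-lookup s (index p) = ∈-lookup (opposite (index p))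

  opp-involutive : ∀ {z} → z ∈ S → opp S (opp S z) ≡ z
  opp-involutive p rewrite lookup-index p | opp-lookup s (index p)
    | opp-lookup s (opposite (index p)) | opposite-involutive (index p) = refl

  opp-reverses : ∀ {x y} → x ∈ S → y ∈ S → x ≺ y → opp S y ≺ opp S x
  opp-reverses p q r rewrite lookup-index p | lookup-index q
    | opp-lookup s (index p) | opp-lookup s (index q) =
    lookup-mono s _ _ (opposite-mono (index p) (index q) (lookup-cancel s _ _ r))

compl : List ℤ → List ℤ
compl w = map (opp (sort w)) w

module _ {w} (d : Distinct w) where

  private
    s = sort-≺ d
    ∈S : ∀ {z} → z ∈ w → z ∈ sort w
    ∈S = ∈-resp-↭ (↭-sym (sort-↭ w))
    ∈w : ∀ {z} → z ∈ sort w → z ∈ w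
    ∈w = ∈-resp-↭ (sort-↭ w)

  opp-opp : map (opp (sort w)) (compl w) ≡ w
  opp-opp = trans (sym (map-∘ w)) (map-id-local (All.tabulate (λ p → opp-involutive s (∈S p))))

  compl-↭ : compl w ↭ w
  compl-↭ = unique-sets⇒↭ (unique-map w (distinct⇒unique d) ∈S) (distinct⇒unique d)
    (λ p → case⁻ (∈-map⁻ (opp (sort w)) p)) back
    where
    case⁻ : ∀ {z} → ∃ (λ x → x ∈ w × z ≡ opp (sort w) x) → z ∈ w
    case⁻ (x , p , refl) = ∈w (opp-∈ s (∈S p))
    back : ∀ {z} → z ∈ w → z ∈ compl w
    back {z} p = subst (_∈ compl w) (opp-involutive s (∈S p))
      (∈-map⁺ (opp (sort w)) (∈w (opp-∈ s (∈S p))))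
    unique-map : ∀ xs → Unique xs → (∀ {z} → z ∈ xs → z ∈ sort w) → Unique (map (opp (sort w)) xs)
    unique-map [] _ _ = []
    unique-map (x ∷ xs) (h ∷ u) f = All.map⁺ (All.tabulate λ p e → All.lookup h p
      (trans (sym (opp-involutive s (f (here refl)))) (trans (cong (opp (sort w)) e) (opp-involutive s (f (there p))))))
      ∷ unique-map xs u (f ∘ there)

  compl-distinct : Distinct (compl w)
  compl-distinct = Distinct-resp-↭ (↭-sym compl-↭) d

-- A word and its complement have the same letters, hence the same sorted list, so both
-- complementations apply the same involution.
compl-involutive : ∀ {w} → Distinct w → compl (compl w) ≡ w
compl-involutive {w} d = trans (cong (λ S → map (opp S) (compl w)) same) (opp-opp d)
  where
  same : sort (compl w) ≡ sort w
  same = sorted-sets⇒≡ {R = _≺_} (λ {x} {y} → ≺-asym {x} {y}) (sort-≺ (compl-distinct d)) (sort-≺ d)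
    (∈-resp-↭ (↭-trans (sort-↭ _) (↭-trans (compl-↭ d) (↭-sym (sort-↭ w)))))
    (∈-resp-↭ (↭-trans (sort-↭ _) (↭-trans (↭-sym (compl-↭ d)) (↭-sym (sort-↭ _)))))

compl-reverses : ∀ {w} → Distinct w → ∀ {x y} → x ∈ w → y ∈ w → x ≺ y → opp (sort w) y ≺ opp (sort w) x
compl-reverses {w} d {x} {y} p q r = opp-reverses (sort-≺ d) {x} {y} (f p) (f q) r
  where
  f : ∀ {z} → z ∈ w → z ∈ sort w
  f = ∈-resp-↭ (↭-sym (sort-↭ w))

-- Signed alternating words and trees

-- [true] asks for an ascent
Step : Bool → ℤ → ℤ → Set
Step b x y = if b then x ≺ y else y ≺ x

Alt : Bool → List ℤ → Set
Alt b [] = ⊤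
Alt b (x ∷ []) = ⊤
Alt b (x ∷ y ∷ w) = Step b x y × Alt (not b) (y ∷ w)

-- The step into the smallest letter descends and the step out of it ascends; since directions
-- alternate from `b`, the parity of `u` is forced. A one-letter word has no steps, hence the first
-- alternative.
alt-split : ∀ b u {m v} → All (m ≺_) u → All (m ≺_) v → Alt b (u ++ m ∷ v) →
  (u ≡ [] × v ≡ []) ⊎ (Alt b u × Alt false v × isEven (length u) ≡ b)
alt-split b [] {v = []} _ _ _ = inj₁ (refl , refl)
alt-split true [] {v = _ ∷ _} _ _ (_ , a) = inj₂ (tt , a , refl)
alt-split false [] {v = _ ∷ _} _ (p ∷ _) (q , _) = contradiction q (ℕ.<-asym p)
alt-split true (_ ∷ []) (p ∷ _) _ (q , _) = contradiction q (ℕ.<-asym p)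
alt-split false (_ ∷ []) {v = []} _ _ _ = inj₂ (tt , tt , refl)
alt-split false (_ ∷ []) {v = _ ∷ _} _ _ (_ , _ , a) = inj₂ (tt , a , refl)
alt-split b (_ ∷ u@(_ ∷ _)) (_ ∷ p) q (s , a) with alt-split (not b) u p q a
... | inj₂ (au , av , e) = inj₂ ((s , au) , av , trans (cong not e) (not-involutive b))

alt-join : ∀ b u {m v} → All (m ≺_) u → All (m ≺_) v → Alt b u → Alt false v →
  isEven (length u) ≡ b → Alt b (u ++ m ∷ v)
alt-join b [] {v = []} _ _ _ _ _ = tt
alt-join true [] {v = _ ∷ _} _ (q ∷ _) _ av _ = q , av
alt-join false (_ ∷ []) {v = []} (p ∷ _) _ _ _ _ = p , tt
alt-join false (_ ∷ []) {v = _ ∷ _} (p ∷ _) (q ∷ _) _ av _ = p , q , av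
alt-join b (_ ∷ u@(_ ∷ _)) (_ ∷ p) q (s , au) av e =
  s , alt-join (not b) u p q au av (trans (sym (not-involutive _)) (cong not e))

-- Generalised over the accumulator of the reversal. The letter `x` is a valley or a peak, so both
-- ways out of it have direction `b`; the parity of `xs` gives the direction at the far end.
alt-ʳ++ : ∀ b x xs acc → Alt b (x ∷ acc) → Alt b (x ∷ xs) →
  Alt (if isEven (length xs) then b else not b) (xs ʳ++ (x ∷ acc))
alt-ʳ++ b x [] acc p _ = p
alt-ʳ++ b x (y ∷ xs) acc p (s , q) = subst (λ c → Alt c (xs ʳ++ (y ∷ x ∷ acc))) (flip (isEven (length xs)))
  (alt-ʳ++ (not b) y xs (x ∷ acc) (turn b s , subst (λ c → Alt c (x ∷ acc)) (sym (not-involutive b)) p) q)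
  where
  turn : ∀ b → Step b x y → Step (not b) y x
  turn true s = s
  turn false s = s
  flip : ∀ e → (if e then not b else not (not b)) ≡ (if not e then b else not b)
  flip true = refl
  flip false = not-involutive b

-- An even number of letters has an odd number of steps, so the last step has the direction of the
-- first, and reading it backwards flips it.
alt-reverse : ∀ b xs → isEven (length xs) ≡ true → Alt b xs → Alt (not b) (reverse xs)
alt-reverse b [] _ _ = tt
alt-reverse b (x ∷ xs) e a = subst (λ c → Alt c (xs ʳ++ [ x ]))
  (cong (λ c → if c then b else not b) (trans (sym (not-involutive _)) (cong not e))) (alt-ʳ++ b x xs [] tt a)

alt-compl : ∀ b {w} → Distinct w → Alt b w → Alt (not b) (compl w)
alt-compl b {w} d = go b w id
  where
  f = opp (sort w)
  go : ∀ b xs → (∀ {z} → z ∈ xs → z ∈ w) → Alt b xs → Alt (not b) (map f xs)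
  go b [] _ _ = tt
  go b (x ∷ []) _ _ = tt
  go b (x ∷ y ∷ xs) i (s , a) = flip b s , go (not b) (y ∷ xs) (i ∘ there) a
    where
    flip : ∀ b → Step b x y → Step (not b) (f x) (f y)
    flip true s = compl-reverses d {x} {y} (i (here refl)) (i (there (here refl))) s
    flip false s = compl-reverses d {y} {x} (i (there (here refl))) (i (here refl)) s

-- Splitting words at the letter of smallest absolute value, and the trees that result

Split : Set
Split = List ℤ × ℤ × List ℤ

extend : ℤ → Maybe Split → Maybe Split
extend x nothing = just ([] , x , [])
extend x (just (u , m , v)) with ∣ x ∣ ℕ.<? ∣ m ∣
... | yes _ = just ([] , x , u ++ m ∷ v)
... | no _ = just (x ∷ u , m , v)

minSplit : List ℤ → Maybe Split
minSplit [] = nothing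
minSplit (x ∷ w) = extend x (minSplit w)

minSplit-nothing : ∀ w → minSplit w ≡ nothing → w ≡ []
minSplit-nothing [] _ = refl
minSplit-nothing (x ∷ w) e with minSplit w
... | just (u , m , v) with ∣ x ∣ ℕ.<? ∣ m ∣
minSplit-nothing (x ∷ w) () | just (u , m , v) | yes _
minSplit-nothing (x ∷ w) () | just (u , m , v) | no _

minSplit-just : ∀ w {u m v} → minSplit w ≡ just (u , m , v) → w ≡ u ++ m ∷ v
minSplit-just (x ∷ w) e with minSplit w in eq
minSplit-just (x ∷ w) refl | nothing = cong (x ∷_) (minSplit-nothing w eq)
... | just (u , m , v) with ∣ x ∣ ℕ.<? ∣ m ∣
minSplit-just (x ∷ w) refl | just (u , m , v) | yes _ = cong (x ∷_) (minSplit-just w eq)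
minSplit-just (x ∷ w) refl | just (u , m , v) | no _ = cong (x ∷_) (minSplit-just w eq)

minSplit-join : ∀ u {m v} → All (m ≺_) u → All (m ≺_) v → minSplit (u ++ m ∷ v) ≡ just (u , m , v)
minSplit-join [] {m} {v} _ q with minSplit v in eq
... | nothing rewrite minSplit-nothing v eq = refl
... | just (u′ , m′ , v′) with ∣ m ∣ ℕ.<? ∣ m′ ∣
...   | yes _ = cong (λ w → just ([] , m , w)) (sym (minSplit-just v eq))
...   | no ¬p rewrite minSplit-just v eq = contradiction (All.lookup q (∈-insert u′)) ¬p
minSplit-join (x ∷ u) {m} {v} (p ∷ ps) q rewrite minSplit-join u {m} {v} ps q with ∣ x ∣ ℕ.<? ∣ m ∣
... | yes r = contradiction r (ℕ.<-asym p)
... | no _ = refl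

-- `minSplit` computes on arbitrary lists; this view adds the proofs of minimality, available for
-- distinct letters. By `minSplit-join` such a decomposition is the one that `minSplit` returns.
data MinView : List ℤ → Set where
  empty : MinView []
  split : ∀ u m v → All (m ≺_) u → All (m ≺_) v → MinView (u ++ m ∷ v)

minView : ∀ w → Distinct w → MinView w
minView [] _ = empty
minView (x ∷ w) (dx ∷ d) with minView w d
... | empty = split [] x [] [] []
... | split u m v p q with ∣ x ∣ ℕ.<? ∣ m ∣
...   | yes r = split [] x (u ++ m ∷ v) [] (All.++⁺ (All.map (ℕ.<-trans r) p) (r ∷ All.map (ℕ.<-trans r) q))
...   | no r = split (x ∷ u) m v (ℕ.≤∧≢⇒< (ℕ.≮⇒≥ r) (All.lookup dx (∈-insert u) ∘ sym) ∷ p) q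

-- The number is fuel, to be at least the length of the word.
Φ : ℕ → List ℤ → Tree
Φ zero w = leaf nothing
Φ (suc f) w with minSplit w
... | nothing = leaf nothing
... | just (_ , -[1+ k ] , _) with minSplit (compl w)
...   | nothing = leaf nothing
...   | just (u , _ , v) = node (suc k) (Φ f (reverse u)) (Φ f v)
Φ (suc f) w | just ([] , + k , v) = leaf (just k)
Φ (suc f) w | just (x ∷ u , + k , v) = node k (Φ f (x ∷ u)) (Φ f v)

-- The complemented word of the negative case: the left word is stored reversed, so that it starts
-- with an ascent when its length is even.
mirror : ℕ → List ℤ → List ℤ → List ℤ
mirror k a b = reverse a ++ (- (+ k)) ∷ b

join : ℕ → List ℤ → List ℤ → List ℤ
join k a b = if isEven (length a) then compl (mirror k a b) else (a ++ (+ k) ∷ b)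

Ψ : Tree → List ℤ
Ψ (leaf nothing) = []
Ψ (leaf (just k)) = [ + k ]
Ψ (node k l r) = join k (Ψ l) (Ψ r)

-- This concerns absolute values, not signs: no letter is zero, because zero has no negative copy
-- that could mark the second case.
Positive : List ℤ → Set
Positive = All (+ 0 ≺_)

record Word (w : List ℤ) : Set where
  constructor word
  field
    distinct : Distinct w
    positive : Positive w
    alternates : Alt false w
open Word

record Fit (k : ℕ) (a b : List ℤ) : Set where
  constructor fit
  field
    wordˡ : Word a
    wordʳ : Word b
    0<k : 0 < k
    apart : Distinct (a ++ b)
    aboveˡ : All (+ k ≺_) a
    aboveʳ : All (+ k ≺_) b
open Fit

distinct-cons : ∀ m {xs} → All (m ≺_) xs → Distinct xs → Distinct (m ∷ xs)
distinct-cons m p d = All.map ℕ.<⇒≢ p ∷ d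

distinct-mid : ∀ {u m v} → All (m ≺_) u → All (m ≺_) v → Distinct (u ++ v) → Distinct (u ++ m ∷ v)
distinct-mid {u} {m} {v} p q d = Distinct-resp-↭ (↭-sym (shift m u v)) (distinct-cons m (All.++⁺ p q) d)

distinct-parts : ∀ {u m v} → Distinct (u ++ m ∷ v) → Distinct (u ++ v)
distinct-parts {u} {m} {v} d with _ ∷ d′ ← Distinct-resp-↭ (shift m u v) d = d′

distinct-++⁻ : ∀ u {v} → Distinct (u ++ v) → Distinct u × Distinct v
distinct-++⁻ u d with p , q , _ ← allPairs-++⁻ u d = p , q

reverse-above : ∀ {P : ℤ → Set} a → All P a → All P (reverse a)
reverse-above a = All-resp-↭ (↭-sym (↭-reverse a))

module _ {k a b} (F : Fit k a b) where

  private
    above⁻ : ∀ {xs} → All (+ k ≺_) xs → All ((- (+ k)) ≺_) xs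
    above⁻ = All.map (ℕ.≤-<-trans (ℕ.≤-reflexive (ℤ.∣-i∣≡∣i∣ (+ k))))

  minus-aboveˡ : All ((- (+ k)) ≺_) (reverse a)
  minus-aboveˡ = reverse-above a (above⁻ (aboveˡ F))

  minus-aboveʳ : All ((- (+ k)) ≺_) b
  minus-aboveʳ = above⁻ (aboveʳ F)

  mirror-distinct : Distinct (mirror k a b)
  mirror-distinct = distinct-mid minus-aboveˡ minus-aboveʳ (Distinct-resp-↭ (++⁺ʳ b (↭-sym (↭-reverse a))) (apart F))

  join-↭ : map ∣_∣ (join k a b) ↭ k ∷ map ∣_∣ a ++ map ∣_∣ b
  join-↭ with isEven (length a)
  ... | false = ↭-trans (↭-map⁺ ∣_∣ (shift (+ k) a b)) (↭-reflexive (cong (k ∷_) (map-++ ∣_∣ a b)))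
  ... | true = ↭-trans (↭-map⁺ ∣_∣ (↭-trans (compl-↭ mirror-distinct)
    (↭-trans (shift (- (+ k)) (reverse a) b) (prep _ (++⁺ʳ b (↭-reverse a))))))
    (↭-reflexive (cong₂ _∷_ (ℤ.∣-i∣≡∣i∣ (+ k)) (map-++ ∣_∣ a b)))

  join-length : length (join k a b) ≡ suc (length a + length b)
  join-length = trans (sym (length-map ∣_∣ (join k a b))) (trans (↭-length join-↭)
    (cong suc (trans (length-++ (map ∣_∣ a)) (cong₂ _+_ (length-map ∣_∣ a) (length-map ∣_∣ b)))))

  -- For odd `a` the left word ends in a peak or is a single letter, so the descent to `k` fits. For
  -- even `a`, reversal makes the first step an ascent, and complementing the mirror turns it into
  -- the required descent.
  join-word : Word (join k a b)
  join-word with isEven (length a) in e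
  ... | false = word (distinct-mid (aboveˡ F) (aboveʳ F) (apart F))
    (All.++⁺ (positive (wordˡ F)) (0<k F ∷ positive (wordʳ F)))
    (alt-join false a (aboveˡ F) (aboveʳ F) (alternates (wordˡ F)) (alternates (wordʳ F)) e)
  ... | true = word (compl-distinct mirror-distinct)
    (All-resp-↭ (↭-sym (compl-↭ mirror-distinct)) (All.++⁺ (reverse-above a (positive (wordˡ F)))
      (subst (0 <_) (sym (ℤ.∣-i∣≡∣i∣ (+ k))) (0<k F) ∷ positive (wordʳ F))))
    (alt-compl true mirror-distinct (alt-join true (reverse a) minus-aboveˡ minus-aboveʳ
      (alt-reverse false a e (alternates (wordˡ F))) (alternates (wordʳ F))
      (trans (cong isEven (length-reverse a)) e)))

≺-minimum : ∀ u {m} v {x} → All (m ≺_) u → All (m ≺_) v → x ∈ u ++ m ∷ v → x ≡ m ⊎ m ≺ x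
≺-minimum u v p q i with ∈-++⁻ u i
... | inj₁ j = inj₂ (All.lookup p j)
... | inj₂ (here e) = inj₁ e
... | inj₂ (there j) = inj₂ (All.lookup q j)

-- Complementing only permutes the letters, so the one of smallest absolute value stays the same,
-- sign included; only its place changes.
minSplit-compl : ∀ u m v → All (m ≺_) u → All (m ≺_) v → Distinct (u ++ m ∷ v) →
  ∃₂ λ u′ v′ → minSplit (compl (u ++ m ∷ v)) ≡ just (u′ , m , v′)
    × All (m ≺_) u′ × All (m ≺_) v′ × compl (u ++ m ∷ v) ≡ u′ ++ m ∷ v′
minSplit-compl u m v p q d = go (minView _ (compl-distinct d)) refl
  where
  go : ∀ {w} → MinView w → compl (u ++ m ∷ v) ≡ w → ∃₂ λ u′ v′ → minSplit (compl (u ++ m ∷ v)) ≡ just (u′ , m , v′)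
    × All (m ≺_) u′ × All (m ≺_) v′ × compl (u ++ m ∷ v) ≡ u′ ++ m ∷ v′
  go empty e with () ← subst (m ∈_) e (∈-resp-↭ (↭-sym (compl-↭ d)) (∈-insert u))
  go (split u′ m′ v′ p′ q′) e with m′≡m
    where
    m′≡m : m′ ≡ m
    m′≡m with ≺-minimum u v p q (∈-resp-↭ (compl-↭ d) (subst (m′ ∈_) (sym e) (∈-insert u′)))
            | ≺-minimum u′ v′ p′ q′ (subst (m ∈_) e (∈-resp-↭ (↭-sym (compl-↭ d)) (∈-insert u)))
    ... | inj₁ eq | _ = eq
    ... | inj₂ _ | inj₁ eq = sym eq
    ... | inj₂ r | inj₂ s = contradiction s (ℕ.<-asym r)
  ... | refl = u′ , v′ , trans (cong minSplit e) (minSplit-join u′ p′ q′) , p′ , q′ , e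

Φ-neg : ∀ f w {k u v u′ v′ m} → minSplit w ≡ just (u , -[1+ k ] , v) → minSplit (compl w) ≡ just (u′ , m , v′) →
  Φ (suc f) w ≡ node (suc k) (Φ f (reverse u′)) (Φ f v′)
Φ-neg f w e₁ e₂ rewrite e₁ | e₂ = refl

Φ-pos : ∀ f w {k x u v} → minSplit w ≡ just (x ∷ u , + k , v) →
  Φ (suc f) w ≡ node k (Φ f (x ∷ u)) (Φ f v)
Φ-pos f w e rewrite e = refl

-- In the even case `- k` is still the smallest letter after complementing, so `Φ` takes its
-- negative branch; a second complementation gives the mirror back, and splitting that returns
-- `reverse a` and `b`.
Φ-join : ∀ f {k a b} → Fit k a b → Φ (suc f) (join k a b) ≡ node k (Φ f a) (Φ f b)
Φ-join f {k} {a} {b} F with isEven (length a) in e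
Φ-join f {suc k} {a} {b} F | true
  with u′ , v′ , s , _ ← minSplit-compl (reverse a) -[1+ k ] b (minus-aboveˡ F) (minus-aboveʳ F) (mirror-distinct F) =
  trans (Φ-neg f (compl (mirror (suc k) a b)) s
    (trans (cong minSplit (compl-involutive (mirror-distinct F))) (minSplit-join (reverse a) (minus-aboveˡ F) (minus-aboveʳ F))))
  (cong (λ a → node (suc k) (Φ f a) (Φ f b)) (reverse-involutive a))
-- Here `- (+ 0)` would be `+ 0` and send `Φ` into its positive branch.
Φ-join f {zero} F | true with () ← 0<k F
-- An odd length makes the left word nonempty, so the root is a node and not a labelled leaf.
Φ-join f {k} {x ∷ a} {b} F | false = Φ-pos f (x ∷ a ++ + k ∷ b) (minSplit-join (x ∷ a) {+ k} (aboveˡ F) (aboveʳ F))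

-- The shapes of a tree read off from words: empty leaf, labelled leaf, node.
data WordView : List ℤ → Set where
  empty : WordView []
  single : ∀ k → 0 < k → WordView [ + k ]
  joined : ∀ {k a b} → Fit k a b → WordView (join k a b)

-- A positive smallest letter is handled by `alt-split` directly. For a negative one the complement
-- starts with an ascent, so `alt-split` gives a left part of even length; reversing that part and
-- complementing back exhibits the word as a join.
wordView : ∀ {w} → Word w → WordView w
wordView {w} W with minView w (distinct W)
... | empty = empty
... | split u (+ k) v p q with alt-split false u p q (alternates W)
...   | inj₁ (refl , refl) = single k (All.head (positive W))
...   | inj₂ (au , av , e) = subst WordView (cong (λ c → if c then mk else (u ++ + k ∷ v)) e)
    (joined (fit (word (proj₁ ds) (All.++⁻ˡ u (positive W)) au)
      (word (proj₂ ds) (All.tail (All.++⁻ʳ u (positive W))) av) (All.head (All.++⁻ʳ u (positive W))) d p q))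
    where
    mk = compl (mirror k u v)
    d = distinct-parts {u} {+ k} {v} (distinct W)
    ds = distinct-++⁻ u d
wordView {w} W | split u n@(-[1+ k ]) v p q
  with u′ , v′ , s , p′ , q′ , e ← minSplit-compl u n v p q (distinct W) = result
    (case (alt-split true u′ p′ q′ (subst (Alt true) e (alt-compl false (distinct W) (alternates W)))))
  where
  case : (u′ ≡ [] × v′ ≡ []) ⊎ (Alt true u′ × Alt false v′ × isEven (length u′) ≡ true) →
    Alt true u′ × Alt false v′ × isEven (length u′) ≡ true
  -- A single negative letter becomes a node with two empty leaves, whereas a single positive letter
  -- is a labelled leaf.
  case (inj₁ (refl , refl)) = tt , tt , refl
  case (inj₂ r) = r
  d₀ : Distinct (u′ ++ n ∷ v′)
  d₀ = subst Distinct e (compl-distinct (distinct W))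
  d = distinct-parts {u′} {n} {v′} d₀
  pos : Positive (u′ ++ n ∷ v′)
  pos = subst Positive e (All-resp-↭ (↭-sym (compl-↭ (distinct W))) (positive W))
  dʳ : Distinct (reverse u′ ++ v′)
  dʳ = Distinct-resp-↭ (++⁺ʳ v′ (↭-sym (↭-reverse u′))) d
  ds = distinct-++⁻ (reverse u′) dʳ
  result : Alt true u′ × Alt false v′ × isEven (length u′) ≡ true → WordView (u ++ n ∷ v)
  result (au , av , ev) = subst WordView back (joined (fit
    (word (proj₁ ds) (reverse-above u′ (All.++⁻ˡ u′ pos)) (alt-reverse true u′ ev au))
    (word (proj₂ ds) (All.tail (All.++⁻ʳ u′ pos)) av) z<s dʳ (reverse-above u′ p′) q′))
    where
    back : join (suc k) (reverse u′) v′ ≡ u ++ n ∷ v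
    back rewrite length-reverse u′ | ev | reverse-involutive u′ =
      trans (cong compl (sym e)) (compl-involutive (distinct W))

-- The induction follows `wordView` rather than the clauses of `Φ`: a joined word is unfolded by
-- `Φ-join`, and its two parts fit into the remaining fuel.
Φ-correct : ∀ f {w} → length w ≤ f → Word w →
  Ψ (Φ f w) ≡ w × labels (Φ f w) ↭ map ∣_∣ w × Increasing (Φ f w)
Φ-correct f l W with wordView W
Φ-correct zero l W | empty = refl , ↭-refl , tt
Φ-correct (suc f) l W | empty = refl , ↭-refl , tt
Φ-correct (suc f) l W | single k _ = refl , ↭-refl , tt
Φ-correct zero l W | joined F with () ← subst (_≤ 0) (join-length F) l
Φ-correct (suc f) l W | joined {k} {a} {b} F rewrite Φ-join f F
  with l′ ← s≤s⁻¹ (subst (_≤ suc f) (join-length F) l)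
  with ea , pa , ia ← Φ-correct f (ℕ.m+n≤o⇒m≤o _ l′) (wordˡ F)
     | eb , pb , ib ← Φ-correct f (ℕ.m+n≤o⇒n≤o (length a) l′) (wordʳ F) =
  cong₂ (join k) ea eb ,
  ↭-trans (prep k (++⁺ pa pb)) (↭-sym (join-↭ F)) ,
  All-resp-↭ (↭-sym pa) (All.map⁺ (aboveˡ F)) , All-resp-↭ (↭-sym pb) (All.map⁺ (aboveʳ F)) , ia , ib

-- The last component covers every sufficient fuel, because recursive calls of `Φ` run on what is
-- left of the fuel and not on the length of their own word.
Ψ-correct : ∀ t → Unique (labels t) → All (0 <_) (labels t) → Increasing t →
  Word (Ψ t) × map ∣_∣ (Ψ t) ↭ labels t × (∀ f → length (Ψ t) ≤ f → Φ f (Ψ t) ≡ t)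
Ψ-correct (leaf nothing) _ _ _ = word [] [] tt , ↭-refl , λ { zero _ → refl ; (suc _) _ → refl }
Ψ-correct (leaf (just k)) _ p _ = word ([] ∷ []) (All.map⁻ p) tt , ↭-refl , λ { (suc _) _ → refl }
Ψ-correct (node k l r) (_ ∷ u) (p ∷ ps) (al , ar , il , ir)
  with ul , ur , _ ← allPairs-++⁻ (labels l) u
  with Wl , pl , fl ← Ψ-correct l ul (All.++⁻ˡ (labels l) ps) il
     | Wr , pr , fr ← Ψ-correct r ur (All.++⁻ʳ (labels l) ps) ir =
  join-word F , ↭-trans (join-↭ F) (prep k (++⁺ pl pr)) , back
  where
  F : Fit k (Ψ l) (Ψ r)
  F = fit Wl Wr p (AllPairs.map⁻ (Unique-resp-↭ (↭-sym (↭-trans (↭-reflexive (map-++ ∣_∣ (Ψ l) (Ψ r))) (++⁺ pl pr))) u))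
    (All.map⁻ (All-resp-↭ (↭-sym pl) al)) (All.map⁻ (All-resp-↭ (↭-sym pr) ar))
  back : ∀ f → length (join k (Ψ l) (Ψ r)) ≤ f → Φ f (join k (Ψ l) (Ψ r)) ≡ node k l r
  back zero q with () ← subst (_≤ 0) (join-length F) q
  back (suc f) q with q′ ← s≤s⁻¹ (subst (_≤ suc f) (join-length F) q) =
    trans (Φ-join f F) (cong₂ (node k) (fl f (ℕ.m+n≤o⇒m≤o _ q′)) (fr f (ℕ.m+n≤o⇒n≤o (length (Ψ l)) q′)))

-- Cycle notations and trees

-- the cycle (k , w₁ , w₂ , …), stored as its leader k and the word w
Cycle : Set
Cycle = ℕ × List ℤ

entries : Cycle → List ℤ
entries (k , w) = + k ∷ w

letters : List Cycle → List ℤ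
letters = concatMap entries

heads : List Cycle → List ℕ
heads = map proj₁

-- The ascent from `k` to the first letter of `w` follows from minimality of `k`, so alternation is
-- imposed on `w` alone, beginning with a descent.
Good : Cycle → Set
Good (k , w) = All (+ k ≺_) w × Alt false w

record Notation (cs : List Cycle) : Set where
  constructor notation
  field
    good : All Good cs
    increasing-heads : AllPairs (_<_ on proj₁) cs
    distinct-letters : Distinct (letters cs)
    positive-letters : Positive (letters cs)

toTree : List Cycle → Tree
toTree [] = leaf nothing
toTree ((k , w) ∷ cs) = node k (Φ (length w) w) (toTree cs)

fromTree : Tree → List Cycle
fromTree (leaf _) = []
fromTree (node k l r) = (k , Ψ l) ∷ fromTree r

heads-below : ∀ {k cs} → All Good cs → All (λ c → k < proj₁ c) cs → All (+ k ≺_) (letters cs)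
heads-below [] [] = []
heads-below ((g , _) ∷ gs) (p ∷ ps) = p ∷ All.++⁺ (All.map (ℕ.<-trans p) g) (heads-below gs ps)

toTree-correct : ∀ {cs} → Notation cs → fromTree (toTree cs) ≡ cs
  × labels (toTree cs) ↭ map ∣_∣ (letters cs)
  × Increasing (toTree cs)
  × rightmostLeaf (toTree cs) ≡ nothing
toTree-correct {[]} _ = refl , ↭-refl , tt , refl
toTree-correct {(k , w) ∷ cs} (notation ((g , a) ∷ gs) (h ∷ hs) (_ ∷ d) (_ ∷ p))
  with dw , dcs , _ ← allPairs-++⁻ w d
  with ew , lw , iw ← Φ-correct (length w) ℕ.≤-refl (word dw (All.++⁻ˡ w p) a)
  with ec , lc , ic , rc ← toTree-correct {cs} (notation gs hs dcs (All.++⁻ʳ w p)) =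
  cong₂ (λ v → (k , v) ∷_) ew ec ,
  ↭-trans (prep k (++⁺ lw lc)) (↭-reflexive (cong (k ∷_) (sym (map-++ ∣_∣ w (letters cs))))) ,
  (All-resp-↭ (↭-sym lw) (All.map⁺ g) , All-resp-↭ (↭-sym lc) (All.map⁺ (heads-below gs h)) , iw , ic) , rc

fromTree-correct : ∀ t → Unique (labels t) → All (0 <_) (labels t) → Increasing t → rightmostLeaf t ≡ nothing →
  toTree (fromTree t) ≡ t × map ∣_∣ (letters (fromTree t)) ↭ labels t × Notation (fromTree t)
fromTree-correct (leaf nothing) _ _ _ _ = refl , ↭-refl , notation [] [] [] []
fromTree-correct (node k l r) (u′ ∷ u) (p ∷ ps) (al , ar , il , ir) e
  with ul , ur , _ ← allPairs-++⁻ (labels l) u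
  with Wl , pl , fl ← Ψ-correct l ul (All.++⁻ˡ (labels l) ps) il
     | er , pr , N ← fromTree-correct r ur (All.++⁻ʳ (labels l) ps) ir e =
  cong₂ (node k) (fl _ ℕ.≤-refl) er , relabel ,
  notation ((All.map⁻ (All-resp-↭ (↭-sym pl) al) , Word.alternates Wl) ∷ Notation.good N)
    (above (fromTree r) (All.map⁻ (All-resp-↭ (↭-sym pr) ar)) ∷ Notation.increasing-heads N)
    (AllPairs.map⁻ (Unique-resp-↭ (↭-sym relabel) (u′ ∷ u)))
    (All.map⁻ (All-resp-↭ (↭-sym relabel) (p ∷ ps)))
  where
  relabel : map ∣_∣ (letters ((k , Ψ l) ∷ fromTree r)) ↭ k ∷ labels l ++ labels r
  relabel = prep k (↭-trans (↭-reflexive (map-++ ∣_∣ (Ψ l) (letters (fromTree r)))) (++⁺ pl pr))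
  above : ∀ cs → All (+ k ≺_) (letters cs) → All (λ c → k < proj₁ c) cs
  above [] _ = []
  above ((_ , w) ∷ cs) (q ∷ qs) = q ∷ above cs (All.++⁻ʳ w qs)

-- The heads increase down the rightmost path, so its deepest node carries the largest. The member
-- `h` makes the list nonempty: the empty notation gives a bare leaf.
rightmost-is-last-head : ∀ {cs h} → AllPairs (_<_ on proj₁) cs → h ∈ heads cs →
  ∃ λ k → rightmostLabel° (toTree cs) ≡ just k × k ∈ heads cs × (∀ {x} → x ∈ heads cs → x ≤ k)
rightmost-is-last-head {(k , _) ∷ []} _ _ = k , refl , here refl , λ { (here refl) → ℕ.≤-refl }
rightmost-is-last-head {(_ , _) ∷ (_ , _) ∷ _} ((p ∷ _) ∷ ps) _ with k , e , i , m ← rightmost-is-last-head ps (here refl) =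
  k , e , there i , λ { (here refl) → ℕ.≤-trans (ℕ.<⇒≤ p) (m (here refl)) ; (there j) → m j }

last-head⇒rightmost : ∀ {cs k} → AllPairs (_<_ on proj₁) cs → k ∈ heads cs → (∀ {x} → x ∈ heads cs → x ≤ k) →
  rightmostLabel° (toTree cs) ≡ just k
last-head⇒rightmost s i max with k′ , e , i′ , m ← rightmost-is-last-head s i =
  trans e (cong just (ℕ.≤-antisym (max i′) (m i)))

rightmost⇒last-head : ∀ {cs k} → AllPairs (_<_ on proj₁) cs → rightmostLabel° (toTree cs) ≡ just k →
  k ∈ heads cs × (∀ {x} → x ∈ heads cs → x ≤ k)
rightmost⇒last-head {_ ∷ _} s e with k′ , e′ , i , m ← rightmost-is-last-head s (here refl)
  with refl ← trans (sym e) e′ = i , m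

-- Orbits of signed permutations

∈-range⁺ : ∀ {n i} → 1 ≤ i → i ≤ n → i ∈ range n
∈-range⁺ {i = suc i} _ i≤n = ∈-map⁺ suc (∈-upTo⁺ i≤n)

∈-range⁻ : ∀ {n i} → i ∈ range n → 1 ≤ i × i ≤ n
∈-range⁻ p with _ , q , refl ← ∈-map⁻ suc p = s≤s z≤n , ∈-upTo⁻ q

range-sorted : ∀ n → AllPairs _<_ (range n)
range-sorted n = AllPairs.map⁺ (AllPairs.applyUpTo⁺₁ id n (λ i<j _ → s≤s i<j))

range-unique : ∀ n → Unique (range n)
range-unique n = AllPairs.map ℕ.<⇒≢ (range-sorted n)

length-range : ∀ n → length (range n) ≡ n
length-range n = trans (length-map suc (upTo n)) (length-upTo n)

lookupD-∈ : ∀ w {i} → i < length w → lookupD w i ∈ w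
lookupD-∈ (_ ∷ _) {zero} _ = here refl
lookupD-∈ (_ ∷ w) {suc i} (s≤s p) = there (lookupD-∈ w p)

lookupD-injective : ∀ {w} → Distinct w → ∀ {i j} → i < length w → j < length w →
  ∣ lookupD w i ∣ ≡ ∣ lookupD w j ∣ → i ≡ j
lookupD-injective (_ ∷ _) {zero} {zero} _ _ _ = refl
lookupD-injective {_ ∷ w} (d ∷ _) {zero} {suc j} _ (s≤s q) e = contradiction e (All.lookup d (lookupD-∈ w q))
lookupD-injective {_ ∷ w} (d ∷ _) {suc i} {zero} (s≤s p) _ e = contradiction (sym e) (All.lookup d (lookupD-∈ w p))
lookupD-injective (_ ∷ ds) {suc i} {suc j} (s≤s p) (s≤s q) e = cong suc (lookupD-injective ds p q e)

≡⊎≡- : ∀ x y → ∣ x ∣ ≡ ∣ y ∣ → x ≡ y ⊎ x ≡ - y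
≡⊎≡- (+ _) (+ _) refl = inj₁ refl
≡⊎≡- (+ _) -[1+ _ ] refl = inj₂ refl
≡⊎≡- -[1+ _ ] (+ _) refl = inj₂ refl
≡⊎≡- -[1+ _ ] -[1+ _ ] refl = inj₁ refl

x≢-x : ∀ x → 0 < ∣ x ∣ → x ≢ - x
x≢-x (+ suc _) _ ()
x≢-x -[1+ _ ] _ ()

In±-neg : ∀ {n} x → In± n x → In± n (- x)
In±-neg {n} x = subst (λ a → 1 ≤ a × a ≤ n) (sym (ℤ.∣-i∣≡∣i∣ x))

-- The orbit of `y` up to, and without, its first visit to `x`; the fuel `f` ends a search that does
-- not meet `x`.
trail : ∀ {n} → SignedPerm n → ℤ → ℕ → ℤ → List ℤ
trail σ x zero y = []
trail σ x (suc f) y with y ℤ.≟ x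
... | yes _ = []
... | no _ = y ∷ trail σ x f (apply σ y)

-- Taking `z` equal to `y` expresses that `y ∷ ys` closes up to a cycle.
Path : ∀ {n} → SignedPerm n → ℤ → List ℤ → ℤ → Set
Path σ y [] z = apply σ y ≡ z
Path σ y (y′ ∷ ys) z = apply σ y ≡ y′ × Path σ y′ ys z

StepAt : Bool → ℕ → ℤ → ℤ → Set
StepAt b i = Step (if isEven i then b else not b)

stepAt⇔upDownAt : ∀ i {a b} → (StepAt true i a b → UpDownAt i ∣ a ∣ ∣ b ∣) × (UpDownAt i ∣ a ∣ ∣ b ∣ → StepAt true i a b)
stepAt⇔upDownAt i with isEven i
... | true = id , id
... | false = id , id

stepAt-suc : ∀ b i {x y} → (StepAt b (suc i) x y → StepAt (not b) i x y) × (StepAt (not b) i x y → StepAt b (suc i) x y)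
stepAt-suc b i with isEven i
... | true = id , id
stepAt-suc b i {x} {y} | false = subst (λ c → Step c x y) (sym (not-involutive b)) , subst (λ c → Step c x y) (not-involutive b)

module _ {n} (σ : SignedPerm n) where

  apply-neg : ∀ x → apply σ (- x) ≡ - apply σ x
  apply-neg (+ zero) = refl
  apply-neg (+ suc i) = refl
  apply-neg -[1+ i ] = sym (ℤ.neg-involutive _)

  iter-neg : ∀ j x → iter σ j (- x) ≡ - iter σ j x
  iter-neg zero x = refl
  iter-neg (suc j) x = trans (cong (apply σ) (iter-neg j x)) (apply-neg (iter σ j x))

  iter-shift : ∀ j x → iter σ j (apply σ x) ≡ iter σ (suc j) x
  iter-shift zero x = refl
  iter-shift (suc j) x = cong (apply σ) (iter-shift j x)

  iter-+ : ∀ i j x → iter σ (i + j) x ≡ iter σ i (iter σ j x)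
  iter-+ zero j x = refl
  iter-+ (suc i) j x = cong (apply σ) (iter-+ i j x)

  -- Since `x` is reached within the fuel, the search stops on meeting `x`, and the last letter
  -- listed is sent to it.
  trail-path : ∀ {x} f {m y z} → m ≤ f → iter σ m y ≡ x → apply σ z ≡ y → Path σ z (trail σ x f y) x
  trail-path zero z≤n e p = trans p e
  trail-path {x} (suc f) {m} {y} m≤f e p with y ℤ.≟ x
  ... | yes y≡x = trans p y≡x
  trail-path (suc f) {zero} m≤f e p | no y≢x = contradiction e y≢x
  trail-path (suc f) {suc m} {y} (s≤s m≤f) e p | no y≢x =
    p , trail-path f m≤f (trans (iter-shift m y) e) refl

  trail-avoids : ∀ x f y → All (_≢ x) (trail σ x f y)
  trail-avoids x zero y = []
  trail-avoids x (suc f) y with y ℤ.≟ x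
  ... | yes _ = []
  ... | no y≢x = y≢x ∷ trail-avoids x f (apply σ y)

  -- The search cannot stop before the end of the path, which avoids `x`, nor go beyond it, where
  -- `x` is met.
  trail-unique : ∀ {x y} ys f → Path σ y ys x → All (_≢ x) ys → length ys ≤ f → trail σ x f (apply σ y) ≡ ys
  trail-unique [] zero _ _ _ = refl
  trail-unique {x} {y} [] (suc f) e _ _ with apply σ y ℤ.≟ x
  ... | yes _ = refl
  ... | no ¬e = contradiction e ¬e
  trail-unique {x} (y′ ∷ ys) (suc f) (refl , p) (q ∷ qs) (s≤s l) with y′ ℤ.≟ x
  ... | yes e = contradiction e q
  ... | no _ = cong (y′ ∷_) (trail-unique ys f p qs l)

  path-end : ∀ {y} ys {z} → Path σ y ys z → iter σ (suc (length ys)) y ≡ z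
  path-end [] p = p
  path-end {y} (y′ ∷ ys) (refl , p) = trans (sym (iter-shift (suc (length ys)) y)) (path-end ys p)

  path-reach : ∀ {y} ys {z a} → Path σ y ys z → a ∈ y ∷ ys → ∃ λ i → iter σ (suc i) a ≡ z
  path-reach ys p (here refl) = length ys , path-end ys p
  path-reach (_ ∷ ys) (_ , p) (there i) = path-reach ys p i

  path-iter : ∀ {y} ys {z} → Path σ y ys z → ∀ {i} → i < length ys → iter σ (suc i) y ∈ ys
  path-iter (_ ∷ _) (e , _) {zero} _ = here e
  path-iter {y} (_ ∷ ys) (refl , p) {suc i} (s≤s l) = there (subst (_∈ ys) (iter-shift (suc i) y) (path-iter ys p l))

  path-from : ∀ {y} ys {z a} → Path σ y ys z → a ∈ ys → ∃ λ i → i < length ys × iter σ (suc i) y ≡ a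
  path-from (_ ∷ _) (e , _) (here refl) = zero , s≤s z≤n , e
  path-from {y} (_ ∷ ys) (refl , p) (there q) with i , l , e ← path-from ys p q = suc i , s≤s l , trans (sym (iter-shift (suc i) y)) e

  path-next : ∀ {y} ys {z a} → Path σ y ys z → a ∈ y ∷ ys → apply σ a ∈ z ∷ ys
  path-next [] e (here refl) = here e
  path-next (_ ∷ _) (e , _) (here refl) = there (here e)
  path-next (_ ∷ ys) (_ , p) (there i) with path-next ys p i
  ... | here e = here e
  ... | there j = there (there j)

  cycle-closed : ∀ {x ys a} → Path σ x ys x → a ∈ x ∷ ys → ∀ j → iter σ j a ∈ x ∷ ys
  cycle-closed p i zero = i
  cycle-closed p i (suc j) = path-next _ p (cycle-closed p i j)

  -- Dropping the first letter of the path lowers every index by one and swaps the direction, which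
  -- is `stepAt-suc`. This links the indexed comparisons of `Alternating` to the recursive `Alt`.
  iter⇒alt : ∀ b {y} ys {z} → Path σ y ys z →
    (∀ i → i < length ys → StepAt b i (iter σ i y) (iter σ (suc i) y)) → Alt b (y ∷ ys)
  iter⇒alt b [] _ _ = tt
  iter⇒alt b {y} (_ ∷ ys) (refl , p) s = s 0 (s≤s z≤n) , iter⇒alt (not b) ys p
    (λ i l → proj₁ (stepAt-suc b i {iter σ i (apply σ y)} {iter σ (suc i) (apply σ y)})
      (subst₂ (StepAt b (suc i)) (sym (iter-shift i y)) (sym (iter-shift (suc i) y)) (s (suc i) (s≤s l))))

  alt⇒iter : ∀ b {y} ys {z} → Path σ y ys z → Alt b (y ∷ ys) →
    ∀ i → i < length ys → StepAt b i (iter σ i y) (iter σ (suc i) y)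
  alt⇒iter b (_ ∷ ys) (refl , p) (s , _) zero _ = s
  alt⇒iter b {y} (_ ∷ ys) (refl , p) (_ , a) (suc i) (s≤s l) =
    subst₂ (StepAt b (suc i)) (iter-shift i y) (iter-shift (suc i) y)
      (proj₂ (stepAt-suc b i {iter σ i (apply σ y)} {iter σ (suc i) (apply σ y)}) (alt⇒iter (not b) ys p a i l))

-- Validity is an irrelevant field of `SignedPerm`, so it is taken again as an ordinary argument
-- that proofs can compute with.
module Permuting {n} (σ : SignedPerm n) (valid : map ∣_∣ (window σ) ↭ range n) where

  window-distinct : Distinct (window σ)
  window-distinct = AllPairs.map⁻ (Unique-resp-↭ (↭-sym valid) (range-unique n))

  window-length : length (window σ) ≡ n
  window-length = trans (sym (length-map ∣_∣ (window σ))) (trans (↭-length valid) (length-range n))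

  private
    bounded : ∀ {i} → suc i ≤ n → i < length (window σ)
    bounded = subst (_ <_) (sym window-length)

  apply-In± : ∀ x → In± n x → In± n (apply σ x)
  apply-In± (+ suc i) (_ , p) = ∈-range⁻ (∈-resp-↭ valid (∈-map⁺ ∣_∣ (lookupD-∈ (window σ) (bounded p))))
  apply-In± -[1+ i ] (_ , p) = In±-neg (lookupD (window σ) i) (∈-range⁻ (∈-resp-↭ valid (∈-map⁺ ∣_∣ (lookupD-∈ (window σ) (bounded p)))))

  iter-In± : ∀ j x → In± n x → In± n (iter σ j x)
  iter-In± zero x p = p
  iter-In± (suc j) x p = apply-In± (iter σ j x) (iter-In± j x p)

  ∣apply∣ : ∀ x {i} → ∣ x ∣ ≡ suc i → ∣ apply σ x ∣ ≡ ∣ lookupD (window σ) i ∣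
  ∣apply∣ (+ suc _) refl = refl
  ∣apply∣ -[1+ i ] refl = ℤ.∣-i∣≡∣i∣ (lookupD (window σ) i)

  ∣apply∣-injective : ∀ x y {a b} → ∣ x ∣ ≡ suc a → ∣ y ∣ ≡ suc b → In± n x → In± n y →
    ∣ apply σ x ∣ ≡ ∣ apply σ y ∣ → a ≡ b
  ∣apply∣-injective x y ea eb (_ , p) (_ , q) e = lookupD-injective window-distinct
    (bounded (subst (_≤ n) ea p)) (bounded (subst (_≤ n) eb q)) (trans (sym (∣apply∣ x ea)) (trans e (∣apply∣ y eb)))

  1≤⇒suc : ∀ {a} → 1 ≤ a → ∃ λ b → a ≡ suc b
  1≤⇒suc (s≤s _) = _ , refl

  apply-injective : ∀ x y → In± n x → In± n y → apply σ x ≡ apply σ y → x ≡ y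
  apply-injective x y p q e
    with a , ea ← 1≤⇒suc (proj₁ p) | b , eb ← 1≤⇒suc (proj₁ q)
    with ≡⊎≡- x y (trans ea (trans (cong suc (∣apply∣-injective x y ea eb p q (cong ∣_∣ e))) (sym eb)))
  ... | inj₁ r = r
  ... | inj₂ refl = contradiction (trans (sym e) (apply-neg σ y)) (x≢-x (apply σ y) (proj₁ (apply-In± y q)))

  iter-cancel : ∀ i j x → In± n x → iter σ i x ≡ iter σ (i + j) x → x ≡ iter σ j x
  iter-cancel zero j x p e = e
  iter-cancel (suc i) j x p e = iter-cancel i j x p
    (apply-injective (iter σ i x) (iter σ (i + j) x) (iter-In± i x p) (iter-In± (i + j) x p) e)

  -- Positive letters get the codes 1 to `n`, negative ones `n + 1` to `n + n`, in preparation for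
  -- the pigeonhole principle.
  code : ℤ → ℕ
  code (+ i) = i
  code -[1+ i ] = n + suc i

  code-bounded : ∀ x → In± n x → code x < suc (n + n)
  code-bounded (+ i) (_ , p) = s≤s (ℕ.m≤n⇒m≤n+o n p)
  code-bounded -[1+ i ] (_ , p) = s≤s (ℕ.+-monoʳ-≤ n p)

  code-injective : ∀ x y → In± n x → In± n y → code x ≡ code y → x ≡ y
  code-injective (+ _) (+ _) _ _ refl = refl
  code-injective (+ _) -[1+ j ] (_ , p) _ refl = contradiction p (ℕ.m+1+n≰m n)
  code-injective -[1+ i ] (+ _) _ (_ , p) refl = contradiction p (ℕ.m+1+n≰m n)
  code-injective -[1+ i ] -[1+ j ] _ _ e with refl ← ℕ.+-cancelˡ-≡ n (suc i) (suc j) e = refl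

  -- Kept abstract: [with] would otherwise normalise the pigeonhole argument, at prohibitive cost.
  abstract
    return : ∀ x → In± n x → ∃ λ r → r ≤ n + n × iter σ (suc r) x ≡ x
    return x p with i , j , i<j , e ← pigeonhole (ℕ.n<1+n (suc (n + n)))
        (λ i → fromℕ< (code-bounded (iter σ (toℕ i) x) (iter-In± (toℕ i) x p))) =
      -- Of `n + n + 2` iterates with codes below `n + n + 1`, two coincide; cancelling the first
      -- `toℕ i` applications leaves a return after `suc r` steps.
      r , ℕ.≤-trans (ℕ.∸-monoˡ-≤ (suc (toℕ i)) (s≤s⁻¹ (toℕ<n j))) (ℕ.m∸n≤m (n + n) (toℕ i)) , sym (iter-cancel (toℕ i) (suc r) x p same)
      where
      r : ℕ
      r = toℕ j ∸ suc (toℕ i)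
      same : iter σ (toℕ i) x ≡ iter σ (toℕ i + suc r) x
      same = trans (code-injective (iter σ (toℕ i) x) (iter σ (toℕ j) x) (iter-In± (toℕ i) x p) (iter-In± (toℕ j) x p)
        (trans (sym (toℕ-fromℕ< _)) (trans (cong toℕ e) (toℕ-fromℕ< _))))
        (cong (λ k → iter σ k x) (sym (trans (ℕ.+-suc (toℕ i) r) (ℕ.m+[n∸m]≡n i<j))))

-- From signed permutations to cycle notations and back

∈-letters⁺ : ∀ {cs c z} → c ∈ cs → z ∈ entries c → z ∈ letters cs
∈-letters⁺ p q = ∈-concatMap⁺ entries (lose p q)

∈-letters⁻ : ∀ {cs z} → z ∈ letters cs → ∃ λ c → c ∈ cs × z ∈ entries c
∈-letters⁻ {cs} p = find (∈-concatMap⁻ entries {xs = cs} p)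

distinct-≡ : ∀ {xs a b} → Distinct xs → a ∈ xs → b ∈ xs → ∣ a ∣ ≡ ∣ b ∣ → a ≡ b
distinct-≡ _ (here refl) (here refl) _ = refl
distinct-≡ (d ∷ _) (here refl) (there q) e = contradiction e (All.lookup d q)
distinct-≡ (d ∷ _) (there p) (here refl) e = contradiction (sym e) (All.lookup d p)
distinct-≡ (_ ∷ ds) (there p) (there q) e = distinct-≡ ds p q e

-- `spanning` expresses that one cycle is listed from each pair of a cycle and its negative: every
-- absolute value occurs exactly once.
record Written (n : ℕ) (cs : List Cycle) : Set where
  constructor written
  field
    good : All Good cs
    increasing-heads : AllPairs (_<_ on proj₁) cs
    spanning : map ∣_∣ (letters cs) ↭ range n

  letters-distinct : Distinct (letters cs)
  letters-distinct = AllPairs.map⁻ (Unique-resp-↭ (↭-sym spanning) (range-unique n))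

  is-notation : Notation cs
  is-notation = notation good increasing-heads letters-distinct
    (All.map⁻ (All-resp-↭ (↭-sym spanning) (All.tabulate (proj₁ ∘ ∈-range⁻))))

  letter-In± : ∀ {z} → z ∈ letters cs → In± n z
  letter-In± p = ∈-range⁻ (∈-resp-↭ spanning (∈-map⁺ ∣_∣ p))

good-head≤ : ∀ {c z} → Good c → z ∈ entries c → proj₁ c ≤ ∣ z ∣
good-head≤ _ (here refl) = ℕ.≤-refl
good-head≤ (g , _) (there p) = ℕ.<⇒≤ (All.lookup g p)

good⇒alt : ∀ {c} → Good c → Alt true (entries c)
good⇒alt {_ , []} _ = tt
good⇒alt {_ , _ ∷ _} (p ∷ _ , a) = p , a

alt-tail : ∀ {x w} → Alt true (x ∷ w) → Alt false w
alt-tail {w = []} _ = tt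
alt-tail {w = _ ∷ _} (_ , a) = a

Realizes : ∀ {n} → SignedPerm n → List Cycle → Set
Realizes σ = All λ (k , w) → Path σ (+ k) w (+ k)

-- The fuel `n + n` is the bound on `r` supplied by `return`.
cycleAt : ∀ {n} → SignedPerm n → ℕ → Cycle
cycleAt {n} σ k = k , trail σ (+ k) (n + n) (apply σ (+ k))

-- A decidable form of `IsLeader`: the condition on all iterates becomes one on the finite list of
-- letters of the cycle.
Leads : ∀ {n} → SignedPerm n → ℕ → Set
Leads σ k = All (λ z → k ≤ ∣ z ∣) (proj₂ (cycleAt σ k))

leads? : ∀ {n} (σ : SignedPerm n) → Decidable (Leads σ)
leads? σ k = all? (λ z → k ℕ.≤? ∣ z ∣) _

leaders : ∀ {n} → SignedPerm n → List ℕ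
leaders {n} σ = filter (leads? σ) (range n)

cyclesOf : ∀ {n} → SignedPerm n → List Cycle
cyclesOf σ = map (cycleAt σ) (leaders σ)

leaders-sorted : ∀ {n} (σ : SignedPerm n) → AllPairs _<_ (leaders σ)
leaders-sorted {n} σ = AllPairs.filter⁺ (leads? σ) (range-sorted n)

minimum : ∀ x xs → ∃ λ m → m ∈ x ∷ xs × All (λ z → ∣ m ∣ ≤ ∣ z ∣) (x ∷ xs)
minimum x [] = x , here refl , ℕ.≤-refl ∷ []
minimum x (y ∷ ys) with m , p , q ← minimum y ys with ℕ.≤-total ∣ x ∣ ∣ m ∣
... | inj₁ l = x , here refl , ℕ.≤-refl ∷ All.map (ℕ.≤-trans l) q
... | inj₂ l = m , there p , l ∷ q

module _ {n} (σ : SignedPerm n) where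

  -- Iterates commute with negation, so their absolute values depend only on that of the starting
  -- point.
  ∣iter∣ : ∀ i {x y} → ∣ x ∣ ≡ ∣ y ∣ → ∣ iter σ i x ∣ ≡ ∣ iter σ i y ∣
  ∣iter∣ i {x} {y} e with ≡⊎≡- x y e
  ... | inj₁ refl = refl
  ... | inj₂ refl = trans (cong ∣_∣ (iter-neg σ i y)) (ℤ.∣-i∣≡∣i∣ (iter σ i y))

  path-member : ∀ {x ys z a} → Path σ x ys z → a ∈ x ∷ ys → ∃ λ i → iter σ i x ≡ a
  path-member p (here refl) = 0 , refl
  path-member p (there q) with i , _ , e ← path-from σ _ p q = suc i , e

  -- A later letter with the absolute value of `y` is `- y`, which a self-negative cycle would
  -- require, or `y` itself, which would let the path reach its end too early.
  path-distinct : NoSelfNegCycle σ → (∀ j x → In± n x → In± n (iter σ j x)) →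
    ∀ {y} ys {x} → In± n y → Path σ y ys x → All (_≢ x) ys → Distinct (y ∷ ys)
  path-distinct nsn inn {y} [] _ _ _ = [] ∷ []
  path-distinct nsn inn {y} (y′ ∷ ys) {x} iy p (a ∷ as) =
    All.tabulate fresh ∷ path-distinct nsn inn ys (subst (In± n) (proj₁ p) (inn 1 y iy)) (proj₂ p) as
    where
    fresh : ∀ {z} → z ∈ y′ ∷ ys → ∣ y ∣ ≢ ∣ z ∣
    fresh {z} q e with i , l , r ← path-from σ (y′ ∷ ys) p q with ≡⊎≡- z y (sym e)
    ... | inj₂ z≡-y = nsn y iy (suc i) (trans r z≡-y)
    -- Cutting out the loop of `suc i` steps at `y` reaches `x` after `suc j` steps, at a position
    -- inside the path, which avoids `x`.
    ... | inj₁ z≡y = All.lookup (a ∷ as) (path-iter σ (y′ ∷ ys) p {j} j<)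
        (trans (sym (cong (iter σ (suc j)) (trans r z≡y)))
        (trans (sym (iter-+ σ (suc j) (suc i) y)) (trans (cong (λ t → iter σ t y) len) (path-end σ (y′ ∷ ys) p))))
      where
      N = length (y′ ∷ ys)
      j = N ∸ suc i
      j< : j < N
      j< = s≤s (ℕ.m∸n≤m (length ys) i)
      len : suc j + suc i ≡ suc N
      len = cong suc (ℕ.m∸n+n≡m l)

module FromPerm {n} (σ : SignedPerm n) (valid : map ∣_∣ (window σ) ↭ range n) where

  open Permuting σ valid

  cycleAt-path : ∀ k → In± n (+ k) → Path σ (+ k) (proj₂ (cycleAt σ k)) (+ k)
  cycleAt-path k p with r , l , e ← return (+ k) p = trail-path σ (n + n) l (trans (iter-shift σ r (+ k)) e) refl

  leads⇒leader : ∀ {k} → In± n (+ k) → Leads σ k → IsLeader σ k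
  leads⇒leader {k} p l = proj₁ p , proj₂ p , λ j →
    All.lookup (ℕ.≤-refl ∷ l) (cycle-closed σ (cycleAt-path k p) (here refl) j)

  leader⇒leads : ∀ {k} → IsLeader σ k → Leads σ k
  leader⇒leads {k} (p , q , l) = All.tabulate λ i → case (path-member σ (cycleAt-path k (p , q)) (there i))
    where
    case : ∀ {z} → (∃ λ i → iter σ i (+ k) ≡ z) → k ≤ ∣ z ∣
    case (i , refl) = l i

  ∈-leaders⁺ : ∀ {k} → IsLeader σ k → k ∈ leaders σ
  ∈-leaders⁺ L@(p , q , _) = ∈-filter⁺ (leads? σ) (∈-range⁺ p q) (leader⇒leads L)

  ∈-leaders⁻ : ∀ {k} → k ∈ leaders σ → IsLeader σ k
  ∈-leaders⁻ i with j , l ← ∈-filter⁻ (leads? σ) {xs = range n} i = leads⇒leader (∈-range⁻ j) l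

  leader-path : ∀ {k} → IsLeader σ k → Path σ (+ k) (proj₂ (cycleAt σ k)) (+ k)
  leader-path {k} (p , q , _) = cycleAt-path k (p , q)

  -- From `k′` the orbit leads to `z′`, and as many further steps as lead from `z` to `k` then end
  -- at `k` up to sign. A leader is at most every absolute value on its orbit.
  same-cycle : ∀ {k k′ z z′} → IsLeader σ k → IsLeader σ k′ → z ∈ entries (cycleAt σ k) → z′ ∈ entries (cycleAt σ k′) →
    ∣ z ∣ ≡ ∣ z′ ∣ → k′ ≤ k
  same-cycle {k} {k′} {z} {z′} L L′ p p′ e
    with i , r ← path-reach σ _ (leader-path L) p | j , r′ ← path-member σ (leader-path L′) p′ =
    ℕ.≤-trans (proj₂ (proj₂ L′) (suc i + j)) (ℕ.≤-reflexive
      (trans (cong ∣_∣ (trans (iter-+ σ (suc i) j (+ k′)) (cong (iter σ (suc i)) r′)))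
      (trans (∣iter∣ σ (suc i) {z′} {z} (sym e)) (cong ∣_∣ r))))

  cyclesOf-realized : Realizes σ (cyclesOf σ)
  cyclesOf-realized = All.map⁺ (All.tabulate (leader-path ∘ ∈-leaders⁻))

  cycleAt-In± : ∀ k z → IsLeader σ k → z ∈ entries (cycleAt σ k) → In± n z
  cycleAt-In± k z L@(p , q , _) i with j , e ← path-member σ (leader-path {k} L) i =
    subst (In± n) e (iter-In± j (+ k) (p , q))

  -- The leader is the absolute value of a smallest letter `m` on the orbit of `i`. For negative `m`
  -- its cycle is the opposite one, so `i` is found there up to sign, after as many steps as lead
  -- from `m` to `i`.
  find-leader : ∀ i → In± n (+ i) → ∃₂ λ k z → IsLeader σ k × z ∈ entries (cycleAt σ k) × ∣ z ∣ ≡ i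
  find-leader i p with m , q , least ← minimum (+ i) (proj₂ (cycleAt σ i)) =
    ∣ m ∣ , iter σ (suc (proj₁ reach)) (+ ∣ m ∣) , L ,
    cycle-closed σ (leader-path {∣ m ∣} L) (here refl) (suc (proj₁ reach)) ,
    trans (∣iter∣ σ (suc (proj₁ reach)) {+ ∣ m ∣} {m} refl) (cong ∣_∣ (proj₂ reach))
    where
    path = cycleAt-path i p
    reach = path-reach σ _ path q
    member = path-member σ path q
    Im : In± n m
    Im = subst (In± n) (proj₂ member) (iter-In± (proj₁ member) (+ i) p)
    L : IsLeader σ ∣ m ∣
    L = proj₁ Im , proj₂ Im , λ l → subst (∣ m ∣ ≤_) (∣iter∣ σ l {m} {+ ∣ m ∣} refl)
      (All.lookup least (cycle-closed σ path q l))

  module _ (cud : IsCUD σ) where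

    cycle-distinct : ∀ {k} → IsLeader σ k → Distinct (entries (cycleAt σ k))
    cycle-distinct {k} L@(p , q , _) =
      path-distinct σ (proj₁ cud) iter-In± _ (p , q) (leader-path L) (trail-avoids σ (+ k) (n + n) (apply σ (+ k)))

    cycle-good : ∀ {k} → IsLeader σ k → Good (cycleAt σ k)
    cycle-good {k} L with d ∷ _ ← cycle-distinct L =
      All.zipWith (λ (p , q) → ℕ.≤∧≢⇒< p q) (leader⇒leads L , d) ,
      alt-tail {+ k} {w} (iter⇒alt σ true w path
        (λ i l → proj₂ (stepAt⇔upDownAt i {iter σ i (+ k)} {iter σ (suc i) (+ k)}) (proj₂ cud k L (suc (length w)) cycle-length i (s≤s l))))
      where
      w = proj₂ (cycleAt σ k)
      path = leader-path L
      cycle-length : CycleLength σ (+ k) (suc (length w))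
      cycle-length = s≤s z≤n , path-end σ w path , λ { (suc j) _ (s≤s l) e →
        All.lookup (trail-avoids σ (+ k) (n + n) (apply σ (+ k))) (path-iter σ w path l) e }

    cycles-distinct : ∀ ks → AllPairs _<_ ks → (∀ {k} → k ∈ ks → IsLeader σ k) → Distinct (letters (map (cycleAt σ) ks))
    cycles-distinct [] _ _ = []
    cycles-distinct (k ∷ ks) (s ∷ ss) L = AllPairs.++⁺ (cycle-distinct (L (here refl))) (cycles-distinct ks ss (L ∘ there))
      (All.tabulate λ p → All.tabulate λ q e → disjoint p (∈-letters⁻ {map (cycleAt σ) ks} q) e)
      where
      disjoint : ∀ {z z′} → z ∈ entries (cycleAt σ k) →
        (∃ λ c → c ∈ map (cycleAt σ) ks × z′ ∈ entries c) → ∣ z ∣ ≢ ∣ z′ ∣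
      disjoint p (_ , i , q) e with k′ , j , refl ← ∈-map⁻ (cycleAt σ) i =
        ℕ.<⇒≱ (All.lookup s j) (same-cycle (L (here refl)) (L (there j)) p q e)

    -- The list of leaders is a variable here, known only through being sorted and having the
    -- leaders as members, so its computation does not unfold.
    module _ (ks : List ℕ) (sorted : AllPairs _<_ ks)
      (all-lead : ∀ {k} → k ∈ ks → IsLeader σ k) (lead-all : ∀ {k} → IsLeader σ k → k ∈ ks) where

      private
        cycles = map (cycleAt σ) ks

      cycles-sound : ∀ {i} → (∃ λ z → z ∈ letters cycles × i ≡ ∣ z ∣) → i ∈ range n
      cycles-sound (z , q , refl) with c , i , r ← ∈-letters⁻ {cycles} q
        with k , l , e ← ∈-map⁻ (cycleAt σ) i
        with p₁ , p₂ ← cycleAt-In± k z (all-lead l) (subst (λ c → z ∈ entries c) e r) = ∈-range⁺ p₁ p₂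

      cycles-complete : ∀ {i} → i ∈ range n → i ∈ map ∣_∣ (letters cycles)
      cycles-complete {i} p with k , z , L , q , e ← find-leader i (∈-range⁻ p) =
        subst (_∈ map ∣_∣ (letters cycles)) e
          (∈-map⁺ ∣_∣ (∈-letters⁺ {cycles} {cycleAt σ k} {z} (∈-map⁺ (cycleAt σ) (lead-all L)) q))

      cycles-good : ∀ js → (∀ {k} → k ∈ js → IsLeader σ k) → All Good (map (cycleAt σ) js)
      cycles-good [] _ = []
      cycles-good (j ∷ js) L = cycle-good {j} (L (here refl)) ∷ cycles-good js (L ∘ there)

      cycles-unique : Unique (map ∣_∣ (letters cycles))
      cycles-unique = AllPairs.map⁺ {R = _≢_} {f = ∣_∣} {xs = letters cycles} (cycles-distinct ks sorted all-lead)

      cycles-written : Written n cycles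
      cycles-written = written (cycles-good ks all-lead)
        (AllPairs.map⁺ {R = _<_ on proj₁} {f = cycleAt σ} sorted)
        (unique-sets⇒↭ cycles-unique (range-unique n) (cycles-sound ∘ ∈-map⁻ ∣_∣) cycles-complete)

    cyclesOf-written : Written n (cyclesOf σ)
    cyclesOf-written = cycles-written (leaders σ) (leaders-sorted σ) ∈-leaders⁻ ∈-leaders⁺

module FromCycles {n} (σ : SignedPerm n) (valid : map ∣_∣ (window σ) ↭ range n)
  {cs} (W : Written n cs) (R : Realizes σ cs) where

  open FromPerm σ valid
  open Written W

  locate : ∀ x → In± n x → ∃₂ λ c z → c ∈ cs × z ∈ entries c × ∣ x ∣ ≡ ∣ z ∣
  locate x (p , q) with z , i , e ← ∈-map⁻ ∣_∣ (∈-resp-↭ (↭-sym spanning) (∈-range⁺ p q))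
    with c , j , k ← ∈-letters⁻ {cs} i = c , z , j , k , e

  -- Some listed letter `z` equals `k` up to sign. The head `h` of its cycle is at most `k` as the
  -- minimum there, and `k` is at most `h` because the orbit of `k` contains `h` up to sign.
  leader⇒head : ∀ {k} → IsLeader σ k → k ∈ heads cs
  leader⇒head {k} (p , q , l) with (h , w) , z , i , j , e ← locate (+ k) (p , q)
    with r , f ← path-reach σ w (All.lookup R i) j = subst (_∈ heads cs) (sym k≡h) (∈-map⁺ proj₁ i)
    where
    k≡h : k ≡ h
    k≡h = ℕ.≤-antisym (ℕ.≤-trans (l (suc r)) (ℕ.≤-reflexive (trans (∣iter∣ σ (suc r) {+ k} {z} e) (cong ∣_∣ f))))
      (ℕ.≤-trans (good-head≤ (All.lookup good i) j) (ℕ.≤-reflexive (sym e)))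

  head-leader : ∀ {k w} → (k , w) ∈ cs → IsLeader σ k
  head-leader i with p , q ← letter-In± (∈-letters⁺ {cs} i (here refl)) =
    p , q , λ j → good-head≤ (All.lookup good i) (cycle-closed σ (All.lookup R i) (here refl) j)

  head⇒leader : ∀ {k} → k ∈ heads cs → IsLeader σ k
  head⇒leader p with _ , i , refl ← ∈-map⁻ proj₁ p = head-leader i

  -- If `x` is sent to `- x`, so is the listed letter `z` with the same absolute value to `- z`. Its
  -- image is listed too, and listed letters are determined by their absolute values, so `z` would
  -- equal `- z`.
  no-self-neg : NoSelfNegCycle σ
  no-self-neg x ix j e with c , z , i , k , ez ← locate x ix = x≢-x z (proj₁ (letter-In± (∈-letters⁺ {cs} i k)))
    (trans (sym (distinct-≡ letters-distinct (∈-letters⁺ {cs} i (cycle-closed σ (All.lookup R i) k j)) (∈-letters⁺ {cs} i k)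
      (trans (∣iter∣ σ j {z} {x} (sym ez)) (trans (cong ∣_∣ e) (trans (ℤ.∣-i∣≡∣i∣ x) ez))))) flip)
    where
    flip : iter σ j z ≡ - z
    flip with ≡⊎≡- x z ez
    ... | inj₁ refl = e
    ... | inj₂ refl = trans (sym (ℤ.neg-involutive _)) (trans (cong -_ (trans (sym (iter-neg σ j z)) e)) (cong -_ (ℤ.neg-involutive z)))

  entries-distinct : ∀ {c} → c ∈ cs → Distinct (entries c)
  entries-distinct i = go cs letters-distinct i
    where
    go : ∀ ds → Distinct (letters ds) → ∀ {c} → c ∈ ds → Distinct (entries c)
    go (d ∷ ds) D (here refl) = proj₁ (allPairs-++⁻ (entries d) D)
    go (d ∷ ds) D (there j) = go ds (proj₁ (proj₂ (allPairs-++⁻ (entries d) D))) j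

  word-avoids-head : ∀ {k w} → (k , w) ∈ cs → All (_≢ + k) w
  word-avoids-head i with d ∷ _ ← entries-distinct i = All.map (λ { h refl → h refl }) d

  alternating : ∀ x → IsLeader σ x → Alternating σ (+ x)
  alternating x L r (s≤s {n = r′} _ , e , least) i (s≤s l) with (k , w) , p , refl ← ∈-map⁻ proj₁ (leader⇒head L) =
    proj₁ (stepAt⇔upDownAt i {iter σ i (+ x)} {iter σ (suc i) (+ x)}) (alt⇒iter σ true w path (good⇒alt (All.lookup good p)) i (subst (i <_) r′≡ l))
    where
    path = All.lookup R p
    -- A smaller `r′` would put the leader among the letters of `w`; a larger one contradicts the
    -- minimality of the period.
    r′≡ : r′ ≡ length w
    r′≡ with ℕ.<-cmp r′ (length w)
    ... | tri< a _ _ = contradiction e (All.lookup (word-avoids-head p) (path-iter σ w path a))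
    ... | tri≈ _ a _ = a
    ... | tri> _ _ a = contradiction (path-end σ w path) (least (suc (length w)) (s≤s z≤n) (s≤s a))

  is-CUD : IsCUD σ
  is-CUD = no-self-neg , alternating

  word-length : ∀ {k w} → (k , w) ∈ cs → length w ≤ n + n
  word-length i = ℕ.m≤n⇒m≤n+o n (ℕ.<⇒≤ (subst (_ <_) (trans (sym (length-map ∣_∣ (letters cs))) (trans (↭-length spanning) (length-range n))) (go cs i)))
    where
    go : ∀ ds {k w} → (k , w) ∈ ds → length w < length (letters ds)
    go ((k , w) ∷ ds) (here refl) = s≤s (ℕ.≤-trans (ℕ.m≤m+n (length w) _) (ℕ.≤-reflexive (sym (length-++ w))))
    go ((k , w) ∷ ds) (there i) = ℕ.<-≤-trans (go ds i) (ℕ.≤-trans (ℕ.m≤n+m _ (suc (length w))) (ℕ.≤-reflexive (sym (length-++ (+ k ∷ w)))))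

  -- Leaders and heads are sorted lists with the same members, hence equal; from each head,
  -- `trail-unique` recovers the written word.
  cyclesOf≡ : cyclesOf σ ≡ cs
  cyclesOf≡ = trans (cong (map (cycleAt σ)) (sorted-sets⇒≡ ℕ.<-asym (leaders-sorted σ) (AllPairs.map⁺ increasing-heads)
      (leader⇒head ∘ ∈-leaders⁻) (∈-leaders⁺ ∘ head⇒leader)))
    (trans (sym (map-∘ cs)) (map-id-local (All.tabulate λ {(k , w)} i →
      cong (k ,_) (trail-unique σ w (n + n) (All.lookup R i) (word-avoids-head i) (word-length i)))))

-- The signed permutation described by a cycle notation

edges : ℤ → List ℤ → ℤ → List (ℤ × ℤ)
edges y [] z = (y , z) ∷ []
edges y (y′ ∷ ys) z = (y , y′) ∷ edges y′ ys z

cycleEdges : Cycle → List (ℤ × ℤ)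
cycleEdges (k , w) = edges (+ k) w (+ k)

allEdges : List Cycle → List (ℤ × ℤ)
allEdges = concatMap cycleEdges

orient : ℤ → ℤ → ℤ
orient (+ _) b = b
orient -[1+ _ ] b = - b

-- an edge (a , b) also describes the edge (- a , - b) of the opposite cycle
image : List (ℤ × ℤ) → ℕ → ℤ
image [] i = + 0
image ((a , b) ∷ es) i with ∣ a ∣ ℕ.≟ i
... | yes _ = orient a b
... | no _ = image es i

windowOf : ℕ → List Cycle → List ℤ
windowOf n cs = map (image (allEdges cs)) (range n)

∣orient∣ : ∀ a b → ∣ orient a b ∣ ≡ ∣ b ∣
∣orient∣ (+ _) b = refl
∣orient∣ -[1+ _ ] b = ℤ.∣-i∣≡∣i∣ b

edges-sources : ∀ y ys z → map proj₁ (edges y ys z) ≡ y ∷ ys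
edges-sources y [] z = refl
edges-sources y (y′ ∷ ys) z = cong (y ∷_) (edges-sources y′ ys z)

edges-targets : ∀ y ys z → map proj₂ (edges y ys z) ≡ ys ∷ʳ z
edges-targets y [] z = refl
edges-targets y (y′ ∷ ys) z = cong (y′ ∷_) (edges-targets y′ ys z)

sources : ∀ cs → map proj₁ (allEdges cs) ≡ letters cs
sources [] = refl
sources ((k , w) ∷ cs) = trans (map-++ proj₁ (edges (+ k) w (+ k)) (allEdges cs))
  (cong₂ _++_ (edges-sources (+ k) w (+ k)) (sources cs))

-- Along each cycle the targets are its letters rotated by one place.
targets : ∀ cs → map proj₂ (allEdges cs) ↭ letters cs
targets [] = ↭-refl
targets ((k , w) ∷ cs) = ↭-trans (↭-reflexive (map-++ proj₂ (edges (+ k) w (+ k)) (allEdges cs)))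
  (++⁺ (↭-trans (↭-reflexive (edges-targets (+ k) w (+ k))) (↭-sym (∷↭∷ʳ (+ k) w))) (targets cs))

image-∈ : ∀ {es a b} → Distinct (map proj₁ es) → (a , b) ∈ es → image es ∣ a ∣ ≡ orient a b
image-∈ {(a , b) ∷ es} _ (here refl) with ∣ a ∣ ℕ.≟ ∣ a ∣
... | yes _ = refl
... | no ¬p = contradiction refl ¬p
image-∈ {(a′ , b′) ∷ es} {a} (d ∷ ds) (there p) with ∣ a′ ∣ ℕ.≟ ∣ a ∣
... | yes e = contradiction e (All.lookup d (∈-map⁺ proj₁ p))
... | no _ = image-∈ ds p

lookupD-map-range : ∀ {n} (g : ℕ → ℤ) {i} → i < n → lookupD (map g (range n)) i ≡ g (suc i)
lookupD-map-range {n} g p = go n id p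
  where
  go : ∀ n f {i} → i < n → lookupD (map g (map suc (applyUpTo f n))) i ≡ g (suc (f i))
  go (suc n) f {zero} _ = refl
  go (suc n) f {suc i} (s≤s l) = go n (f ∘ suc) l

lookupD-ext : ∀ v w → length v ≡ length w → (∀ i → i < length v → lookupD v i ≡ lookupD w i) → v ≡ w
lookupD-ext [] [] _ _ = refl
lookupD-ext (x ∷ v) (y ∷ w) l e = cong₂ _∷_ (e 0 (s≤s z≤n)) (lookupD-ext v w (ℕ.suc-injective l) (λ i p → e (suc i) (s≤s p)))

module _ {n cs} (W : Written n cs) where

  open Written W

  private
    es = allEdges cs
    sources-distinct : Distinct (map proj₁ es)
    sources-distinct = subst Distinct (sym (sources cs)) letters-distinct

  -- Up to order, `range n` consists of the absolute values of the sources; their images have the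
  -- absolute values of the targets, which are the same letters again.
  windowOf-valid : map ∣_∣ (windowOf n cs) ↭ range n
  windowOf-valid = ↭-trans (↭-map⁺ ∣_∣ (↭-map⁺ (image es) (↭-sym spanning)))
    (↭-trans (↭-reflexive same) (↭-trans (↭-map⁺ ∣_∣ (targets cs)) spanning))
    where
    same : map ∣_∣ (map (image es) (map ∣_∣ (letters cs))) ≡ map ∣_∣ (map proj₂ es)
    same rewrite sym (sources cs) | sym (map-∘ {g = ∣_∣} {f = proj₁} es)
      | sym (map-∘ {g = image es} {f = ∣_∣ ∘ proj₁} es)
      | sym (map-∘ {g = ∣_∣} {f = image es ∘ ∣_∣ ∘ proj₁} es)
      | sym (map-∘ {g = ∣_∣} {f = proj₂} es) =
      map-cong-local (All.tabulate λ {(a , b)} p → trans (cong ∣_∣ (image-∈ sources-distinct p)) (∣orient∣ a b))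

  apply-edge : ∀ (σ : SignedPerm n) → window σ ≡ windowOf n cs → ∀ a b → (a , b) ∈ es → apply σ a ≡ b
  apply-edge σ e a b p = go a b p (letter-In± (subst (a ∈_) (sources cs) (∈-map⁺ proj₁ p)))
    where
    go : ∀ a b → (a , b) ∈ es → In± n a → apply σ a ≡ b
    go (+ suc i) b p (_ , l) = trans (cong (λ w → lookupD w i) e) (trans (lookupD-map-range (image es) l) (image-∈ sources-distinct p))
    go -[1+ i ] b p (_ , l) = trans (cong -_ (trans (cong (λ w → lookupD w i) e)
      (trans (lookupD-map-range (image es) l) (image-∈ sources-distinct p)))) (ℤ.neg-involutive b)

  windowOf-realizes : ∀ (σ : SignedPerm n) → window σ ≡ windowOf n cs → Realizes σ cs
  windowOf-realizes σ e = All.tabulate λ {(k , w)} i → path (+ k) w (+ k)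
    (λ p → apply-edge σ e _ _ (∈-concatMap⁺ cycleEdges (lose i p)))
    where
    path : ∀ y ys z → (∀ {a b} → (a , b) ∈ edges y ys z → apply σ a ≡ b) → Path σ y ys z
    path y [] z f = f (here refl)
    path y (y′ ∷ ys) z f = f (here refl) , path y′ ys z (f ∘ there)

module _ {n} (σ τ : SignedPerm n) where

  path-agree : ∀ {y} ys {z a} → Path σ y ys z → Path τ y ys z → a ∈ y ∷ ys → apply σ a ≡ apply τ a
  path-agree [] p q (here refl) = trans p (sym q)
  path-agree (_ ∷ _) (p , _) (q , _) (here refl) = trans p (sym q)
  path-agree (_ ∷ ys) (_ , p) (_ , q) (there i) = path-agree ys p q i

  -- Every argument is, up to sign, a listed letter. There both permutations follow the same path,
  -- and the other sign follows since both commute with negation.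
  realization-unique : map ∣_∣ (window σ) ↭ range n → map ∣_∣ (window τ) ↭ range n →
    ∀ {cs} → Written n cs → Realizes σ cs → Realizes τ cs → window σ ≡ window τ
  realization-unique vσ vτ {cs} W Rσ Rτ = lookupD-ext (window σ) (window τ)
    (trans (Permuting.window-length σ vσ) (sym (Permuting.window-length τ vτ)))
    λ i l → agree i (subst (i <_) (Permuting.window-length σ vσ) l)
    where
    agree : ∀ i → i < n → apply σ (+ suc i) ≡ apply τ (+ suc i)
    agree i l with (k , w) , z , p , q , e ← FromCycles.locate σ vσ W Rσ (+ suc i) (s≤s z≤n , l)
      with same ← path-agree w (All.lookup Rσ p) (All.lookup Rτ p) q
      with ≡⊎≡- (+ suc i) z e
    ... | inj₁ r = trans (cong (apply σ) r) (trans same (cong (apply τ) (sym r)))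
    ... | inj₂ r = trans (cong (apply σ) r) (trans (apply-neg σ z) (trans (cong -_ same)
      (trans (sym (apply-neg τ z)) (cong (apply τ) (sym r)))))

-- The bijection between permutations and trees, and the last leader

_≟ᵀ_ : DecidableEquality Tree
leaf m ≟ᵀ leaf m′ = map′ (cong leaf) (λ { refl → refl }) (Maybe.≡-dec ℕ._≟_ m m′)
leaf _ ≟ᵀ node _ _ _ = no λ ()
node _ _ _ ≟ᵀ leaf _ = no λ ()
node x l r ≟ᵀ node x′ l′ r′ = map′ (λ { (refl , refl , refl) → refl }) (λ { refl → refl , refl , refl })
  (x ℕ.≟ x′ ×-dec l ≟ᵀ l′ ×-dec r ≟ᵀ r′)

module CUD→T° {n} (σ : SignedPerm n) (valid : map ∣_∣ (window σ) ↭ range n) (cud : IsCUD σ) where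

  open FromPerm σ valid

  W : Written n (cyclesOf σ)
  W = cyclesOf-written cud

  tree-correct : fromTree (toTree (cyclesOf σ)) ≡ cyclesOf σ
    × labels (toTree (cyclesOf σ)) ↭ map ∣_∣ (letters (cyclesOf σ))
    × Increasing (toTree (cyclesOf σ))
    × rightmostLeaf (toTree (cyclesOf σ)) ≡ nothing
  tree-correct = toTree-correct (Written.is-notation W)

  tree-labelling : labels (toTree (cyclesOf σ)) ↭ range n
  tree-labelling = ↭-trans (proj₁ (proj₂ tree-correct)) (Written.spanning W)

  window-recovered : windowOf n (fromTree (toTree (cyclesOf σ))) ≡ window σ
  window-recovered = trans (cong (windowOf n) (proj₁ tree-correct))
    (realization-unique τ σ (windowOf-valid W) valid W (windowOf-realizes W τ refl) cyclesOf-realized)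
    where
    τ : SignedPerm n
    τ = mkSP (windowOf n (cyclesOf σ)) (windowOf-valid W)

  open FromCycles σ valid W cyclesOf-realized using (leader⇒head; head⇒leader)

  last-leader⇒rightmost : ∀ {k} → IsLeader σ k → (∀ x → IsLeader σ x → x ≤ k) →
    rightmostLabel° (toTree (cyclesOf σ)) ≡ just k
  last-leader⇒rightmost L max =
    last-head⇒rightmost (Written.increasing-heads W) (leader⇒head L) (λ i → max _ (head⇒leader i))

  rightmost⇒last-leader : ∀ {k} → rightmostLabel° (toTree (cyclesOf σ)) ≡ just k →
    IsLeader σ k × (∀ x → IsLeader σ x → x ≤ k)
  rightmost⇒last-leader {k} e = head⇒leader (proj₁ last) , λ x L → proj₂ last (leader⇒head L)
    where
    last : k ∈ heads (cyclesOf σ) × (∀ {x} → x ∈ heads (cyclesOf σ) → x ≤ k)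
    last = rightmost⇒last-head (Written.increasing-heads W) e

module T°→CUD {n} (t : Tree) (labelled : labels t ↭ range n) (inc : Increasing t) (emp : rightmostLeaf t ≡ nothing) where

  private
    facts = fromTree-correct t (Unique-resp-↭ (↭-sym labelled) (range-unique n))
      (All-resp-↭ (↭-sym labelled) (All.tabulate (proj₁ ∘ ∈-range⁻))) inc emp

  W : Written n (fromTree t)
  W = written (Notation.good (proj₂ (proj₂ facts))) (Notation.increasing-heads (proj₂ (proj₂ facts)))
    (↭-trans (proj₁ (proj₂ facts)) labelled)

  σ : SignedPerm n
  σ = mkSP (windowOf n (fromTree t)) (windowOf-valid W)

  open FromCycles σ (windowOf-valid W) W (windowOf-realizes W σ refl) public using (is-CUD; cyclesOf≡)

  tree-recovered : toTree (cyclesOf σ) ≡ t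
  tree-recovered = trans (cong toTree cyclesOf≡) (proj₁ facts)

treeOf : ∀ {n} → CUD n → T° n
treeOf (mkCUD σ@(mkSP _ v) u) = mkT° (toTree (cyclesOf σ)) (CUD→T°.tree-labelling σ v u)
  (proj₁ (proj₂ (proj₂ (CUD→T°.tree-correct σ v u)))) (proj₂ (proj₂ (proj₂ (CUD→T°.tree-correct σ v u))))

permOf : ∀ {n} → T° n → CUD n
permOf {n} (mkT° t l i e) = mkCUD (mkSP (windowOf n (fromTree t)) (windowOf-valid (T°→CUD.W t l i e))) (T°→CUD.is-CUD t l i e)

T°-≡ : ∀ {n} {s t : T° n} → tree s ≡ tree t → s ≡ t
T°-≡ refl = refl

CUD-≡ : ∀ {n} {c d : CUD n} → window (perm c) ≡ window (perm d) → c ≡ d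
CUD-≡ refl = refl

-- The proof of `tree-recovered` depends on irrelevant fields; decidable equality of trees turns it
-- into a usable one by `recompute`.
treeOf-permOf : ∀ {n} (t : T° n) → treeOf (permOf t) ≡ t
treeOf-permOf (mkT° t l i e) = T°-≡ (recompute (_ ≟ᵀ t) (T°→CUD.tree-recovered t l i e))

permOf-treeOf : ∀ {n} (c : CUD n) → permOf (treeOf c) ≡ c
permOf-treeOf (mkCUD σ@(mkSP w v) u) = CUD-≡ (recompute (≡-dec ℤ._≟_ _ w) (CUD→T°.window-recovered σ v u))

-- The quantifiers over `j` and `x` are kept outside, so that only inequalities between natural
-- numbers have to be decided.
LastLeaderIs-recompute : ∀ {n k} (c : CUD n) → .(LastLeaderIs c k) → LastLeaderIs c k
LastLeaderIs-recompute {n} {k} c last =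
  (recompute (1 ℕ.≤? k) (proj₁ (proj₁ last)) , recompute (k ℕ.≤? n) (proj₁ (proj₂ (proj₁ last))) ,
    λ j → recompute (k ℕ.≤? _) (proj₂ (proj₂ (proj₁ last)) j)) ,
  λ x L → recompute (x ℕ.≤? k) (proj₂ last x L)

last-leader⇔rightmost : ∀ {n} (c : CUD n) k → LastLeaderIs c k ⇔ (rightmostLabel° (tree (treeOf c)) ≡ just k)
last-leader⇔rightmost c@(mkCUD σ@(mkSP _ v) u) k = mk⇔
  (λ (L , max) → recompute (Maybe.≡-dec ℕ._≟_ _ _) (CUD→T°.last-leader⇒rightmost σ v u L max))
  (λ e → LastLeaderIs-recompute c (CUD→T°.rightmost⇒last-leader σ v u e))

theorem5p2 : (n : ℕ) → 1 ≤ n →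
    Σ (CUD n ↔ T° n) λ φ →
    (k : ℕ) → 1 ≤ k → k ≤ n → (c : CUD n) →
    LastLeaderIs c k ⇔ (rightmostLabel° (tree (Inverse.to φ c)) ≡ just k)
theorem5p2 n _ = mk↔ₛ′ treeOf permOf treeOf-permOf permOf-treeOf , λ k _ _ c → last-leader⇔rightmost c k
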